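{- Up to isomorphism, there are exactly 3 graphs that are 4-vertex-critical and $(P_5,\text{gem})$-free, and there are exactly 6 graphs that are 4-vertex-critical and $(P_5,\overline{P_3+P_2})$-free.
   Context: All graphs are finite and simple. $P_t$ is the path on $t$ vertices. The gem is the graph obtained from an induced path $P_4$ by adding one vertex adjacent to all four vertices of the path. $\overline{P_3+P_2}$ is the complement of the disjoint union of $P_3$ and $P_2$, i.e. the graph on vertices $a,b,c,d,e$ with edges $ac,da,db,dc,ea,eb,ec$. A graph $G$ is $H$-free if no induced subgraph of $G$ is isomorphic to $H$, and $(H_1,H_2)$-free if it is both $H_1$-free and $H_2$-free. A graph $G$ is $k$-vertex-critical if $\chi(G)=k$ and $\chi(G-v)<k$ for every vertex $v$. -}

module Defs where

open import Data.Nat using (ℕ; zero; suc; _<_)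
open import Data.Fin using (Fin; zero; suc; punchIn; _≟_)
open import Data.Bool using (Bool; true; false; not; _∧_; _∨_)
open import Data.Bool.Properties using (∨-comm)
open import Data.List using (List; []; _∷_)
open import Data.Bool.ListAction using (any)
open import Data.Product using (Σ; _×_; _,_; ∃)
open import Data.Empty using (⊥)
open import Relation.Nullary using (¬_; yes; no)
open import Relation.Nullary.Decidable using (⌊_⌋)
open import Relation.Binary.PropositionalEquality using (_≡_; _≢_; refl; cong₂)
open import Function.Bundles using (_↔_; Inverse)
open import Function.Definitions using (Injective)

record Graph (n : ℕ) : Set where
  field
    adj    : Fin n → Fin n → Bool
    sym    : ∀ i j → adj i j ≡ adj j i
    irrefl : ∀ i → adj i i ≡ false
open Graph public

_≅_ : ∀ {n m} → Graph n → Graph m → Set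
_≅_ {n} {m} G H = Σ (Fin n ↔ Fin m) λ f →
  ∀ i j → adj G i j ≡ adj H (Inverse.to f i) (Inverse.to f j)

InducedSub : ∀ {h n} → Graph h → Graph n → Set
InducedSub {h} {n} H G = Σ (Fin h → Fin n) λ f →
  Injective _≡_ _≡_ f × (∀ i j → adj H i j ≡ adj G (f i) (f j))

Free : ∀ {n h} → Graph n → Graph h → Set
Free G H = ¬ InducedSub H G

Colorable : ∀ {n} → Graph n → ℕ → Set
Colorable {n} G k = Σ (Fin n → Fin k) λ c → ∀ i j → adj G i j ≡ true → c i ≢ c j

HasChromaticNumber : ∀ {n} → Graph n → ℕ → Set
HasChromaticNumber G k = Colorable G k × (∀ j → j < k → ¬ Colorable G j)

deleteVertex : ∀ {m} → Graph (suc m) → Fin (suc m) → Graph m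
deleteVertex G v = record
  { adj = λ i j → adj G (punchIn v i) (punchIn v j)
  ; sym = λ i j → sym G (punchIn v i) (punchIn v j)
  ; irrefl = λ i → irrefl G (punchIn v i) }

VertexCritical : ℕ → ∀ {n} → Graph n → Set
VertexCritical k {zero} G = HasChromaticNumber G k
VertexCritical k {suc m} G = HasChromaticNumber G k ×
  (∀ v → ∃ λ j → j < k × HasChromaticNumber (deleteVertex G v) j)

ExactlyUpToIso : ℕ → (∀ {n} → Graph n → Set) → Set
ExactlyUpToIso k P =
  Σ (Fin k → Σ ℕ Graph) λ R →
    (∀ i → P (Data.Product.proj₂ (R i))) ×
    (∀ i j → i ≢ j → ¬ (Data.Product.proj₂ (R i) ≅ Data.Product.proj₂ (R j))) ×
    (∀ {n} (G : Graph n) → P G → ∃ λ i → G ≅ Data.Product.proj₂ (R i))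

private
  ≟-refl : ∀ {n} (i : Fin n) → ⌊ i ≟ i ⌋ ≡ true
  ≟-refl i with i ≟ i
  ... | yes _ = refl
  ... | no ¬p = Data.Empty.⊥-elim (¬p refl)

  ≟-sym : ∀ {n} (i j : Fin n) → ⌊ i ≟ j ⌋ ≡ ⌊ j ≟ i ⌋
  ≟-sym i j with i ≟ j | j ≟ i
  ... | yes _ | yes _ = refl
  ... | no _  | no _  = refl
  ... | yes p | no q  = Data.Empty.⊥-elim (q (Relation.Binary.PropositionalEquality.sym p))
  ... | no p  | yes q = Data.Empty.⊥-elim (p (Relation.Binary.PropositionalEquality.sym q))

  inList : ∀ {n} → List (Fin n × Fin n) → Fin n → Fin n → Bool
  inList es i j = any (λ { (a , b) → ⌊ a ≟ i ⌋ ∧ ⌊ b ≟ j ⌋ }) es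

fromEdges : ∀ {n} → List (Fin n × Fin n) → Graph n
fromEdges es = record
  { adj = λ i j → not ⌊ i ≟ j ⌋ ∧ (inList es i j ∨ inList es j i)
  ; sym = λ i j → cong₂ (λ x y → not x ∧ y) (≟-sym i j) (∨-comm (inList es i j) (inList es j i))
  ; irrefl = λ i → cong₂ (λ x y → not x ∧ y) (≟-refl i) refl }

v0 v1 v2 v3 v4 : Fin 5
v0 = zero
v1 = suc zero
v2 = suc (suc zero)
v3 = suc (suc (suc zero))
v4 = suc (suc (suc (suc zero)))

P5 : Graph 5
P5 = fromEdges ((v0 , v1) ∷ (v1 , v2) ∷ (v2 , v3) ∷ (v3 , v4) ∷ [])

gem : Graph 5
gem = fromEdges ((v0 , v1) ∷ (v1 , v2) ∷ (v2 , v3) ∷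
                 (v4 , v0) ∷ (v4 , v1) ∷ (v4 , v2) ∷ (v4 , v3) ∷ [])

-- complement of P3 + P2: a,b,c,d,e = v0..v4, edges ac, da, db, dc, ea, eb, ec
coP3P2 : Graph 5
coP3P2 = fromEdges ((v0 , v2) ∷ (v3 , v0) ∷ (v3 , v1) ∷ (v3 , v2) ∷
                    (v4 , v0) ∷ (v4 , v1) ∷ (v4 , v2) ∷ [])

module Submission where

-- A critical graph G is isomorphic to each of its induced subgraphs that is not 3-colourable, so it
-- suffices that G contains P₅, the second forbidden graph, or one of the listed graphs. Let I be an
-- induced subgraph of G and A a nonempty set of vertices of I such that every 3-colouring of I − A
-- extends to I, where some a in A are moreover required to get the colour of a prescribed vertex φ(a)
-- of I − A. Take a 3-colouring of G − a₀ with a₀ in A, and recolour A. As G is not 3-colourable, some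
-- vertex w outside I is adjacent to an a in A, and not adjacent to φ(a) if φ(a) is prescribed. Looking
-- at all possible neighbourhoods of w in I, one finds either one of the desired graphs or another
-- graph I that was excluded by the same argument before. A suitable finite sequence of graphs I ends
-- with the graph on one vertex.

open import Defs hiding (sym; irrefl)
open import Data.Bool using (Bool; true; false)
import Data.Bool as Bool
open import Data.Empty using (⊥; ⊥-elim)
open import Data.Fin using (Fin; zero; suc; punchOut; inject≤; _≟_)
open import Data.Fin.Permutation using (↔⇒≡)
open import Data.Fin.Properties using (any?; all?; punchIn-punchOut; inject≤-injective)
open import Data.List using (List; []; _∷_; _∷ʳ_; length)
import Data.List as List
open import Data.List.Relation.Unary.Any using (Any; here; there)
import Data.List.Relation.Unary.Any as Any
open import Data.List.Relation.Unary.Any.Properties using (++⁻; lookup-index; map⁻)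
open import Data.Maybe using (Maybe; just; nothing)
import Data.Maybe.Properties as Maybe
open import Data.Nat using (ℕ; zero; suc; _≤_; _<_; s≤s; z≤n; _≡ᵇ_; _/_; _%_)
import Data.Nat as ℕ
open import Data.Nat.Properties using (≤-refl)
open import Data.Product using (Σ; ∃; _×_; _,_; proj₁; proj₂)
open import Data.Sum using (_⊎_; inj₁; inj₂)
open import Data.Unit using (⊤; tt)
open import Data.Vec using (Vec; []; _∷_; lookup; tabulate; replicate; _[_]≔_)
open import Data.Vec.Properties using (lookup∘tabulate; lookup∘update; lookup∘update′; lookup-replicate)
open import Function using (_∘_; id)
open import Function.Bundles using (mk↔ₛ′; Inverse)
open import Function.Definitions using (Injective)
open import Relation.Nullary using (¬_; Dec; yes; no)
open import Relation.Nullary.Decidable using (map′; _×-dec_; _⊎-dec_; _→-dec_; ¬?; toWitness; decidable-stable)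
open import Relation.Binary.PropositionalEquality using (_≡_; _≢_; refl; sym; trans; cong; cong₂; subst; subst₂)

-- Search for colourings and embeddings

-- Unary constraints are kept apart from binary ones so that a choice already made can be absorbed
-- into `U`; `Q` is tested on complete vectors only and holds conditions that do not split into
-- pairs.
Assignment : ∀ {k m} → (Fin m → Fin k → Set) → (Fin m → Fin m → Fin k → Fin k → Set) →
             (Vec (Fin k) m → Set) → Set
Assignment {k} {m} U R Q = ∃ λ (v : Vec (Fin k) m) →
  (∀ i → U i (lookup v i)) × (∀ i j → R i j (lookup v i) (lookup v j)) × Q v

-- Backtracking with forward checking: the value chosen for variable 0 is pushed into the unary
-- constraints of the remaining variables.
assignment? : ∀ {k m} {U : Fin m → Fin k → Set} {R : Fin m → Fin m → Fin k → Fin k → Set}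
              {Q : Vec (Fin k) m → Set} →
              (∀ i a → Dec (U i a)) → (∀ i j a b → Dec (R i j a b)) → (∀ v → Dec (Q v)) →
              Dec (Assignment U R Q)
assignment? {m = zero} U? R? Q? =
  map′ (λ q → [] , (λ ()) , (λ ()) , q) (λ { ([] , _ , _ , q) → q }) (Q? [])
assignment? {k} {suc m} {U} {R} {Q} U? R? Q? = map′ cons uncons
  (any? λ a → U? zero a ×-dec R? zero zero a a ×-dec
    assignment? (λ i b → U? (suc i) b ×-dec R? zero (suc i) a b ×-dec R? (suc i) zero b a)
                (λ i j → R? (suc i) (suc j))
                (λ v → Q? (a ∷ v)))
  where
  U′ : Fin k → Fin m → Fin k → Set
  U′ a i b = U (suc i) b × R zero (suc i) a b × R (suc i) zero b a
  Split : Fin k → Set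
  Split a = U zero a × R zero zero a a ×
            Assignment (U′ a) (λ i j → R (suc i) (suc j)) (λ v → Q (a ∷ v))
  cons : ∃ Split → Assignment U R Q
  cons (a , u , r , v , us , rs , q) = a ∷ v , us′ , rs′ , q
    where
    us′ : ∀ i → U i (lookup (a ∷ v) i)
    us′ zero    = u
    us′ (suc i) = proj₁ (us i)
    rs′ : ∀ i j → R i j (lookup (a ∷ v) i) (lookup (a ∷ v) j)
    rs′ zero    zero    = r
    rs′ zero    (suc j) = proj₁ (proj₂ (us j))
    rs′ (suc i) zero    = proj₂ (proj₂ (us i))
    rs′ (suc i) (suc j) = rs i j
  uncons : Assignment U R Q → ∃ Split
  uncons (a ∷ v , us , rs , q) = a , us zero , rs zero zero , v ,
    (λ i → us (suc i) , rs zero (suc i) , rs (suc i) zero) , (λ i j → rs (suc i) (suc j)) , q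

-- Proper colourings and induced embeddings are both functions restricted only by conditions on
-- pairs. `R` is transported pointwise between a function and its table, which avoids function
-- extensionality.
pairwise? : ∀ {k m} {R : Fin m → Fin m → Fin k → Fin k → Set} → (∀ i j a b → Dec (R i j a b)) →
            Dec (∃ λ (f : Fin m → Fin k) → ∀ i j → R i j (f i) (f j))
pairwise? {R = R} R? = map′ (λ { (v , _ , r , _) → lookup v , r })
  (λ { (f , r) → tabulate f , (λ _ → tt) ,
       (λ i j → subst₂ (R i j) (sym (lookup∘tabulate f i)) (sym (lookup∘tabulate f j)) (r i j)) , tt })
  (assignment? (λ _ _ → yes tt) R? (λ _ → yes tt))

colorable? : ∀ {n} (G : Graph n) k → Dec (Colorable G k)
colorable? G k = pairwise? λ i j a b → (adj G i j Bool.≟ true) →-dec ¬? (a ≟ b)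

inducedSub? : ∀ {h n} (H : Graph h) (G : Graph n) → Dec (InducedSub H G)
inducedSub? H G = map′
  (λ { (f , p) → f , (λ {i} {j} → proj₂ (p i j)) , λ i j → proj₁ (p i j) })
  (λ { (f , inj , p) → f , λ i j → p i j , inj })
  -- Injectivity is a condition on pairs too, so it prunes the search together with adjacency.
  (pairwise? λ i j a b → (adj H i j Bool.≟ adj G a b) ×-dec ((a ≟ b) →-dec (i ≟ j)))

-- Induced subgraphs, colourability and criticality

InducedSub-trans : ∀ {a b c} {A : Graph a} {B : Graph b} {C : Graph c} →
                   InducedSub A B → InducedSub B C → InducedSub A C
InducedSub-trans (f , f-inj , p) (g , g-inj , q) =
  g ∘ f , f-inj ∘ g-inj , λ i j → trans (p i j) (q (f i) (f j))

≅⇒InducedSub : ∀ {n m} (G : Graph n) (H : Graph m) → G ≅ H → InducedSub G H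
≅⇒InducedSub G H (f , p) = Inverse.to f , (λ {i} {j} e → trans (sym (Inverse.strictlyInverseʳ f i))
  (trans (cong (Inverse.from f) e) (Inverse.strictlyInverseʳ f j))) , p

Colorable-mono : ∀ {n j k} (G : Graph n) → j ≤ k → Colorable G j → Colorable G k
Colorable-mono G j≤k (c , p) = (λ i → inject≤ (c i) j≤k) , λ i j e q → p i j e (inject≤-injective j≤k j≤k _ _ q)

hasChromaticNumber : ∀ {n k} (G : Graph n) → Colorable G (suc k) → ¬ Colorable G k →
                     HasChromaticNumber G (suc k)
hasChromaticNumber G c ¬c = c , λ { j (s≤s j≤k) → ¬c ∘ Colorable-mono G j≤k }

-- A colouring of G - v, kept as a function on all vertices whose value at `v` is ignored. This
-- avoids renumbering by `punchIn`.
ProperOff : ∀ {n k} → Graph n → Fin n → (Fin n → Fin k) → Set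
ProperOff G v c = ∀ i j → i ≢ v → j ≢ v → adj G i j ≡ true → c i ≢ c j

Critical : ∀ {n} → Graph n → Set
Critical G = ¬ Colorable G 3 × ∀ v → ∃ λ (c : Fin _ → Fin 3) → ProperOff G v c

undelete : ∀ {m} (G : Graph (suc m)) v → Colorable (deleteVertex G v) 3 →
           ∃ λ (c : Fin (suc m) → Fin 3) → ProperOff G v c
undelete {m} G v (c , p) = e , proper
  where
  e : Fin (suc m) → Fin 3
  e i with v ≟ i
  -- An arbitrary colour: `ProperOff` never looks at `v`.
  ... | yes _   = zero
  ... | no v≢i = c (punchOut v≢i)
  proper : ProperOff G v e
  proper i j i≢v j≢v ij with v ≟ i | v ≟ j
  ... | yes v≡i | _       = ⊥-elim (i≢v (sym v≡i))
  ... | _       | yes v≡j = ⊥-elim (j≢v (sym v≡j))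
  ... | no v≢i  | no v≢j = p _ _
    (subst₂ (λ x y → adj G x y ≡ true) (sym (punchIn-punchOut v≢i)) (sym (punchIn-punchOut v≢j)) ij)

VertexCritical⇒Critical : ∀ {n} (G : Graph n) → VertexCritical 4 G → Critical G
-- The empty graph is 0-colourable, so its chromatic number is not 4.
VertexCritical⇒Critical {zero}  G (_ , ¬c) = ⊥-elim (¬c 0 (s≤s z≤n) ((λ ()) , λ ()))
VertexCritical⇒Critical {suc m} G ((_ , ¬c) , del) = ¬c 3 ≤-refl , λ v → off v (del v)
  where
  off : ∀ v → (∃ λ j → j < 4 × HasChromaticNumber (deleteVertex G v) j) →
        ∃ λ (c : Fin (suc m) → Fin 3) → ProperOff G v c
  off v (j , s≤s j≤3 , c , _) = undelete G v (Colorable-mono (deleteVertex G v) j≤3 c)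

-- Deleting one vertex lowers the chromatic number by at most one, so the number `j` in
-- `VertexCritical 4` can only be 3, and two colourability tests per vertex settle it.
Certified4Critical : ∀ {m} → Graph (suc m) → Set
Certified4Critical G = Colorable G 4 × ¬ Colorable G 3 ×
  ∀ v → Colorable (deleteVertex G v) 3 × ¬ Colorable (deleteVertex G v) 2

certified4Critical? : ∀ {m} (G : Graph (suc m)) → Dec (Certified4Critical G)
certified4Critical? G = colorable? G 4 ×-dec ¬? (colorable? G 3) ×-dec
  all? λ v → colorable? (deleteVertex G v) 3 ×-dec ¬? (colorable? (deleteVertex G v) 2)

Certified4Critical⇒VertexCritical : ∀ {m} (G : Graph (suc m)) → Certified4Critical G → VertexCritical 4 G
Certified4Critical⇒VertexCritical G (c , ¬c , del) = hasChromaticNumber G c ¬c ,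
  λ v → 3 , ≤-refl , hasChromaticNumber (deleteVertex G v) (proj₁ (del v)) (proj₂ (del v))

-- If the embedding missed a vertex v, a 3-colouring of G - v would restrict to one of `H`. So the
-- embedding is onto, and its inverse is found by search among the finitely many vertices of `H`.
non3Colorable-sub⇒≅ : ∀ {h n} (H : Graph h) (G : Graph n) → ¬ Colorable H 3 → Critical G →
                      InducedSub H G → G ≅ H
non3Colorable-sub⇒≅ H G ¬c (_ , off) (f , inj , p) =
  mk↔ₛ′ (proj₁ ∘ pre) f (λ i → inj (proj₂ (pre (f i)))) (proj₂ ∘ pre) ,
  λ i j → trans (sym (cong₂ (adj G) (proj₂ (pre i)) (proj₂ (pre j)))) (sym (p _ _))
  where
  pre : ∀ v → ∃ λ i → f i ≡ v
  pre v = decidable-stable (any? λ i → f i ≟ v) λ miss → ¬c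
    ((proj₁ (off v) ∘ f) , λ i j ij → proj₂ (off v) (f i) (f j)
      (λ e → miss (i , e)) (λ e → miss (j , e)) (trans (sym (p i j)) ij))

-- Graphs encoded by lists of numbers

extend : ∀ {n} → Graph n → (Fin n → Bool) → Graph (suc n)
extend {n} G S = record { adj = adj⁺ ; sym = sym⁺ ; irrefl = irrefl⁺ }
  where
  adj⁺ : Fin (suc n) → Fin (suc n) → Bool
  adj⁺ zero    zero    = false
  adj⁺ zero    (suc j) = S j
  adj⁺ (suc i) zero    = S i
  adj⁺ (suc i) (suc j) = adj G i j
  sym⁺ : ∀ i j → adj⁺ i j ≡ adj⁺ j i
  sym⁺ zero    zero    = refl
  sym⁺ zero    (suc j) = refl
  sym⁺ (suc i) zero    = refl
  sym⁺ (suc i) (suc j) = Graph.sym G i j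
  irrefl⁺ : ∀ i → adj⁺ i i ≡ false
  irrefl⁺ zero    = refl
  irrefl⁺ (suc i) = Graph.irrefl G i

-- The number c encodes the neighbours of the newest vertex, bit i standing for the (i + 1)-st
-- newest of the older vertices; a list of such numbers has the newest vertex first, and the code of
-- the oldest one is omitted.
bits : ∀ {n} → ℕ → Fin n → Bool
bits c zero    = c % 2 ≡ᵇ 1
bits c (suc i) = bits (c / 2) i

fromCodes : (cs : List ℕ) → Graph (suc (length cs))
fromCodes []       = record { adj = λ _ _ → false ; sym = λ _ _ → refl ; irrefl = λ _ → refl }
fromCodes (c ∷ cs) = extend (fromCodes cs) (bits c)

-- Recolouring part of an induced subgraph

-- Relative to a subgraph I, the vertices not marked keep form the set A to be recoloured, and
-- copy b asks for the colour of b.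
data Role (V : Set) : Set where
  keep free : Role V
  copy      : V → Role V

Kept : ∀ {V} → Role V → Set
Kept keep     = ⊤
Kept free     = ⊥
Kept (copy _) = ⊥

kept? : ∀ {V} (r : Role V) → Dec (Kept r)
kept? keep     = yes tt
kept? free     = no id
kept? (copy _) = no id

-- The vertices of A carry only a dummy colour in `c`. The factor `Kept (roles b)` therefore makes a
-- request to copy from inside A unsatisfiable.
Agree : ∀ {k q} → (Fin k → Role (Fin k)) → Vec (Fin q) k → Fin k → Fin q → Set
Agree roles c i x with roles i
... | keep   = x ≡ lookup c i
... | free   = ⊤
... | copy b = Kept (roles b) × x ≡ lookup c b

agree? : ∀ {k q} (roles : Fin k → Role (Fin k)) (c : Vec (Fin q) k) i x → Dec (Agree roles c i x)
agree? roles c i x with roles i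
... | keep   = x ≟ lookup c i
... | free   = yes tt
... | copy b = kept? (roles b) ×-dec (x ≟ lookup c b)

module Recolouring {k} (I : Graph k) (roles : Fin k → Role (Fin k)) where

  Recolours : Vec (Fin 3) k → Set
  Recolours c = Assignment (Agree roles c) (λ i j x y → x ≡ y → adj I i j ≢ true) (λ _ → ⊤)

  recolours? : ∀ c → Dec (Recolours c)
  recolours? c = assignment? (agree? roles c)
    (λ i j x y → (x ≟ y) →-dec ¬? (adj I i j Bool.≟ true)) (λ _ → yes tt)

  -- A 3-colouring of I − A that cannot be recoloured; A is given the dummy colour 0 so that each
  -- colouring of I − A is enumerated once.
  Obstruction : Set
  Obstruction = Assignment (λ i x → ¬ Kept (roles i) → x ≡ zero)
    (λ i j x y → x ≡ y → adj I i j ≡ true → Kept (roles i) → ¬ Kept (roles j))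
    (λ c → ¬ Recolours c)

  obstruction? : Dec Obstruction
  obstruction? = assignment? (λ i x → ¬? (kept? (roles i)) →-dec (x ≟ zero))
    (λ i j x y → (x ≟ y) →-dec (adj I i j Bool.≟ true) →-dec kept? (roles i) →-dec ¬? (kept? (roles j)))
    (λ c → ¬? (recolours? c))

  -- The first factor supplies the vertex of A whose deletion makes G 3-colourable; the second lets
  -- any such colouring, restricted to I - A, be extended to I.
  Reducible : Set
  Reducible = (∃ λ i → ¬ Kept (roles i)) × ¬ Obstruction

  reducible? : Dec Reducible
  reducible? = any? (λ i → ¬? (kept? (roles i))) ×-dec ¬? obstruction?

-- `S` is the neighbourhood in I of an outside vertex w, and `x` its value at the vertex with the
-- given role. A new colour can clash with w only if w is adjacent to that vertex. If the colour is
-- that of `b` and w is also adjacent to `b`, the old colouring already rules out the clash.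
Breaks : ∀ {k} → Role (Fin k) → (Fin k → Bool) → Bool → Set
Breaks keep     S x = ⊥
Breaks free     S x = x ≡ true
Breaks (copy b) S x = x ≡ true × S b ≡ false

breaks? : ∀ {k} (r : Role (Fin k)) S x → Dec (Breaks r S x)
breaks? keep     S x = no id
breaks? free     S x = x Bool.≟ true
breaks? (copy b) S x = (x Bool.≟ true) ×-dec (S b Bool.≟ false)

-- A vertex outside the subgraph that blocks the recolouring

module _ {n k} (G : Graph n) (I : Graph k) (roles : Fin k → Role (Fin k)) (crit : Critical G)
         (e : InducedSub I G) where

  open Recolouring I roles

  private
    f : Fin k → Fin n
    f = proj₁ e

    row : Fin n → Fin k → Bool
    row w i = adj G w (f i)

  Escapes : Fin n → Set
  Escapes w = (∀ i → f i ≢ w) × ∃ λ a → Breaks (roles a) (row w) (row w a)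

  escapes? : ∀ w → Dec (Escapes w)
  escapes? w = all? (λ i → ¬? (f i ≟ w)) ×-dec any? (λ a → breaks? (roles a) (row w) (row w a))

  -- A 3-colouring `c` of G without `f a` is restricted to I - A, extended to I, and glued to `c`
  -- outside I. Edges inside I are proper by the extension, edges outside I by `c`, and edges
  -- between the two by `border`.
  no-escape⇒Colorable : Reducible → ¬ ∃ Escapes → Colorable G 3
  no-escape⇒Colorable ((a , a-moved) , unobstructed) none = col , proper
    where
    c : Fin n → Fin 3
    c = proj₁ (proj₂ crit (f a))

    c-proper : ProperOff G (f a) c
    c-proper = proj₂ (proj₂ crit (f a))

    restricted : Fin k → Fin 3
    restricted i with kept? (roles i)
    ... | yes _ = c (f i)
    -- The dummy colour that `Obstruction` prescribes on A.
    ... | no _  = zero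

    restricted-kept : ∀ i → Kept (roles i) → restricted i ≡ c (f i)
    restricted-kept i κ with kept? (roles i)
    ... | yes _ = refl
    ... | no ¬κ = ⊥-elim (¬κ κ)

    restricted-moved : ∀ i → ¬ Kept (roles i) → restricted i ≡ zero
    restricted-moved i ¬κ with kept? (roles i)
    ... | yes κ = ⊥-elim (¬κ κ)
    ... | no _  = refl

    kept-≢ : ∀ i → Kept (roles i) → f i ≢ f a
    kept-≢ i κ eq = a-moved (subst (Kept ∘ roles) (proj₁ (proj₂ e) eq) κ)

    recoloured : Recolours (tabulate restricted)
    -- Decidability turns the absence of an obstruction into an actual recolouring.
    recoloured = decidable-stable (recolours? _) λ ¬r → unobstructed (tabulate restricted ,
      (λ i ¬κ → trans (lookup∘tabulate restricted i) (restricted-moved i ¬κ)) ,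
      (λ i j eq ij κi κj → subst₂ _≢_
        (sym (trans (lookup∘tabulate restricted i) (restricted-kept i κi)))
        (sym (trans (lookup∘tabulate restricted j) (restricted-kept j κj)))
        (c-proper (f i) (f j) (kept-≢ i κi) (kept-≢ j κj) (trans (sym (proj₂ (proj₂ e) i j)) ij)) eq) ,
      ¬r)

    d : Fin k → Fin 3
    d = lookup (proj₁ recoloured)

    Inside : Fin n → Set
    Inside x = ∃ λ i → f i ≡ x

    inside? : ∀ x → Dec (Inside x)
    inside? x = any? λ i → f i ≟ x

    col : Fin n → Fin 3
    col x with inside? x
    ... | yes (i , _) = d i
    ... | no _        = c x

    kept-colour : ∀ i → Kept (roles i) → lookup (tabulate restricted) i ≡ c (f i)
    kept-colour i κ = trans (lookup∘tabulate restricted i) (restricted-kept i κ)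

    -- As `y` lies outside I, it is not the deleted vertex, so `c` is proper at `y`. A kept vertex
    -- has its old colour, and a copied colour is safe when `y` is adjacent to its source. In every
    -- other case `y` escapes.
    border : ∀ i y → ¬ Inside y → adj G y (f i) ≡ true → d i ≢ c y
    -- Abstracting `roles i` together with the condition on the new colour lets `Agree` reduce in
    -- each case.
    border i y out yi with roles i in eq | proj₁ (proj₂ recoloured) i
    ... | keep   | di rewrite di | kept-colour i (subst Kept (sym eq) tt) =
      c-proper (f i) y (kept-≢ i (subst Kept (sym eq) tt)) (λ y≡ → out (a , sym y≡))
               (trans (Graph.sym G (f i) y) yi)
    ... | free   | _ = ⊥-elim (none (y , (λ j fj → out (j , fj)) , i ,
      subst (λ r → Breaks r (row y) (row y i)) (sym eq) yi))
    ... | copy b | κb , di rewrite di | kept-colour b κb with adj G y (f b) in yb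
    ...   | true  = c-proper (f b) y (kept-≢ b κb) (λ y≡ → out (a , sym y≡))
                             (trans (Graph.sym G (f b) y) yb)
    ...   | false = ⊥-elim (none (y , (λ j fj → out (j , fj)) , i ,
      subst (λ r → Breaks r (row y) (row y i)) (sym eq) (yi , yb)))

    proper : ∀ x y → adj G x y ≡ true → col x ≢ col y
    proper x y xy with inside? x | inside? y
    ... | yes (i , refl) | yes (j , refl) =
      λ eq → proj₁ (proj₂ (proj₂ recoloured)) i j eq (trans (proj₂ (proj₂ e) i j) xy)
    ... | yes (i , refl) | no out = border i y out (trans (Graph.sym G y (f i)) xy)
    ... | no out | yes (j , refl) = border j x out xy ∘ sym
    ... | no outx | no outy = c-proper x y (λ x≡ → outx (a , sym x≡)) (λ y≡ → outy (a , sym y≡)) xy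

  -- G is not 3-colourable, so it is impossible that no vertex escapes; as `Escapes` is decidable on
  -- finitely many vertices, one is found.
  escape : Reducible → ∃ Escapes
  escape red = decidable-stable (any? escapes?) (proj₁ crit ∘ no-escape⇒Colorable red)

-- Decision trees for the neighbourhood of the new vertex

-- A decision tree for the adjacencies between a new vertex w and I. At a stop leaf w is known not to
-- be the vertex whose existence is guaranteed; sub p is embeds the p-th graph of the list, where
-- vertex 0 is w and the vertices of I are shifted by one. The first branch of ask is nonadjacency.
data Tree : Set where
  stop : Tree
  sub  : ℕ → List ℕ → Tree
  ask  : ℕ → Tree → Tree → Tree

-- Out-of-range numbers are sent to the last vertex, so that certificates need no bounds proofs.
clamp : ∀ k → ℕ → Fin (suc k)
clamp k       zero    = zero
clamp zero    (suc _) = zero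
clamp (suc k) (suc i) = suc (clamp k i)

-- Short lists are padded with 0 and long ones cut off. This is harmless, because `SubPartial` is
-- checked for the resulting vector.
vertices : ∀ {k} h → List ℕ → Vec (Fin (suc k)) h
vertices zero    _        = []
vertices (suc h) []       = zero ∷ vertices h []
vertices (suc h) (i ∷ is) = clamp _ i ∷ vertices h is

-- `nothing` marks an adjacency that has not been asked for yet.
PartialRow : ℕ → Set
PartialRow k = Vec (Maybe Bool) k

-- The negation of `Breaks`, as far as the known adjacencies already force it.
Vacuous : ∀ {k} → PartialRow k → Role (Fin k) → Maybe Bool → Set
Vacuous ρ keep     x = ⊤
Vacuous ρ free     x = x ≡ just false
Vacuous ρ (copy b) x = x ≡ just false ⊎ lookup ρ b ≡ just true

_≟ᵐ_ : (x y : Maybe Bool) → Dec (x ≡ y)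
_≟ᵐ_ = Maybe.≡-dec Bool._≟_

vacuous? : ∀ {k} (ρ : PartialRow k) r x → Dec (Vacuous ρ r x)
vacuous? ρ keep     x = yes tt
vacuous? ρ free     x = x ≟ᵐ just false
vacuous? ρ (copy b) x = (x ≟ᵐ just false) ⊎-dec (lookup ρ b ≟ᵐ just true)

partialAdj : ∀ {k} → Graph k → PartialRow k → Fin (suc k) → Fin (suc k) → Maybe Bool
partialAdj I ρ zero    zero    = just false
partialAdj I ρ zero    (suc j) = lookup ρ j
partialAdj I ρ (suc i) zero    = lookup ρ i
partialAdj I ρ (suc i) (suc j) = just (adj I i j)

-- The `just` on the left excludes `nothing`, so the embedding may rely on known adjacencies only.
SubPartial : ∀ {h k} → Graph h → Graph k → PartialRow k → Vec (Fin (suc k)) h → Set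
SubPartial H I ρ v = ∀ i j → (lookup v i ≡ lookup v j → i ≡ j) ×
  just (adj H i j) ≡ partialAdj I ρ (lookup v i) (lookup v j)

AnyGraph : Set
AnyGraph = Σ ℕ Graph

_⊑_ : AnyGraph → ∀ {n} → Graph n → Set
(_ , H) ⊑ G = InducedSub H G

-- The vector is supplied for every length, since the order of the chosen graph is known only after
-- walking down the list. A position past the end is rejected.
SubAt : ∀ {k} → List AnyGraph → ℕ → Graph k → PartialRow k → (∀ h → Vec (Fin (suc k)) h) → Set
SubAt []            _       I ρ v = ⊥
SubAt ((h , H) ∷ Γ) zero    I ρ v = SubPartial H I ρ (v h)
SubAt (_ ∷ Γ)       (suc p) I ρ v = SubAt Γ p I ρ v

subAt? : ∀ {k} Γ p (I : Graph k) ρ v → Dec (SubAt Γ p I ρ v)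
subAt? []            _       I ρ v = no id
subAt? ((h , H) ∷ Γ) zero    I ρ v = all? λ i → all? λ j →
  ((lookup (v h) i ≟ lookup (v h) j) →-dec (i ≟ j)) ×-dec
  (just (adj H i j) ≟ᵐ partialAdj I ρ (lookup (v h) i) (lookup (v h) j))
subAt? (_ ∷ Γ)       (suc p) I ρ v = subAt? Γ p I ρ v

module _ (Γ : List AnyGraph) {k} (I : Graph (suc k)) (roles : Fin (suc k) → Role (Fin (suc k))) where

  Valid : PartialRow (suc k) → Tree → Set
  Valid ρ stop        = ∀ a → Vacuous ρ (roles a) (lookup ρ a)
  Valid ρ (sub p is)  = SubAt Γ p I ρ (λ h → vertices h is)
  Valid ρ (ask v l r) = Valid (ρ [ clamp k v ]≔ just false) l × Valid (ρ [ clamp k v ]≔ just true) r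

  valid? : ∀ ρ t → Dec (Valid ρ t)
  valid? ρ stop        = all? λ a → vacuous? ρ (roles a) (lookup ρ a)
  valid? ρ (sub p is)  = subAt? Γ p I ρ (λ h → vertices h is)
  valid? ρ (ask v l r) =
    valid? (ρ [ clamp k v ]≔ just false) l ×-dec valid? (ρ [ clamp k v ]≔ just true) r

-- Soundness of decision trees

Knows : ∀ {k} → PartialRow k → (Fin k → Bool) → Set
Knows ρ S = ∀ i b → lookup ρ i ≡ just b → S i ≡ b

knows-update : ∀ {k} (ρ : PartialRow k) S v {b} → S v ≡ b → Knows ρ S → Knows (ρ [ v ]≔ just b) S
knows-update ρ S v Sv know i x eq with i ≟ v
... | yes refl = trans Sv (Maybe.just-injective (trans (sym (lookup∘update i ρ _)) eq))
... | no i≢v   = know i x (trans (sym (lookup∘update′ i≢v ρ _)) eq)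

vacuous⇒¬breaks : ∀ {k} {ρ : PartialRow k} {S} → Knows ρ S → ∀ r a →
                  Vacuous ρ r (lookup ρ a) → ¬ Breaks r S (S a)
vacuous⇒¬breaks know free     a ρa Sa with trans (sym Sa) (know a _ ρa)
... | ()
vacuous⇒¬breaks know (copy b) a (inj₁ ρa) (Sa , _) with trans (sym Sa) (know a _ ρa)
... | ()
vacuous⇒¬breaks know (copy b) a (inj₂ ρb) (_ , Sb) with trans (sym Sb) (know b _ ρb)
... | ()

module Insertion {n k} (G : Graph n) (I : Graph k) (e : InducedSub I G) (w : Fin n)
                 (w-new : ∀ i → proj₁ e i ≢ w) where

  neighbourhood : Fin k → Bool
  neighbourhood i = adj G w (proj₁ e i)

  insert : Fin (suc k) → Fin n
  insert zero    = w
  insert (suc i) = proj₁ e i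

  insert-injective : Injective _≡_ _≡_ insert
  insert-injective {zero}  {zero}  _  = refl
  insert-injective {zero}  {suc j} eq = ⊥-elim (w-new j (sym eq))
  insert-injective {suc i} {zero}  eq = ⊥-elim (w-new i eq)
  insert-injective {suc i} {suc j} eq = cong suc (proj₁ (proj₂ e) eq)

  module _ (ρ : PartialRow k) (know : Knows ρ neighbourhood) where

    -- The intermediate `b` separates two equations, so that `x` can be determined by matching on
    -- `refl` even where `partialAdj` is stuck on a `lookup`.
    partialAdj-sound : ∀ i j b → b ≡ partialAdj I ρ i j → ∀ x → b ≡ just x →
                       x ≡ adj G (insert i) (insert j)
    partialAdj-sound zero    zero    _ refl x refl = sym (Graph.irrefl G w)
    partialAdj-sound zero    (suc j) _ eq   x refl = sym (know j x (sym eq))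
    partialAdj-sound (suc i) zero    _ eq   x refl = trans (sym (know i x (sym eq))) (Graph.sym G _ _)
    partialAdj-sound (suc i) (suc j) _ refl x refl = proj₂ (proj₂ e) i j

    subPartial-sound : ∀ {h} (H : Graph h) v → SubPartial H I ρ v → InducedSub H G
    subPartial-sound H v s = insert ∘ lookup v ,
      (λ {i} {j} eq → proj₁ (s i j) (insert-injective eq)) ,
      λ i j → partialAdj-sound (lookup v i) (lookup v j) _ (proj₂ (s i j)) _ refl

    subAt-sound : ∀ Γ p v → SubAt Γ p I ρ v → Any (_⊑ G) Γ
    subAt-sound ((h , H) ∷ Γ) zero    v s = here (subPartial-sound H (v h) s)
    subAt-sound (_ ∷ Γ)       (suc p) v s = there (subAt-sound Γ p v s)

-- The true adjacencies of `w` select one path through the tree. It cannot end in `stop`, because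
-- `w` breaks some role, so it ends in an embedding.
valid-sound : ∀ Γ {n k} (G : Graph n) (I : Graph (suc k)) roles (e : InducedSub I G) w
              (w-new : ∀ i → proj₁ e i ≢ w) → let open Insertion G I e w w-new in
              (∃ λ a → Breaks (roles a) neighbourhood (neighbourhood a)) →
              ∀ ρ t → Knows ρ neighbourhood → Valid Γ I roles ρ t → Any (_⊑ G) Γ
valid-sound Γ G I roles e w w-new (a , br) ρ stop know vac =
  ⊥-elim (vacuous⇒¬breaks know (roles a) a (vac a) br)
valid-sound Γ G I roles e w w-new br ρ (sub p is) know s =
  Insertion.subAt-sound G I e w w-new ρ know Γ p _ s
valid-sound Γ {k = k} G I roles e w w-new br ρ (ask v l r) know (vl , vr)
  with adj G w (proj₁ e (clamp k v)) in eq
... | false = valid-sound Γ G I roles e w w-new br _ l (knows-update ρ _ (clamp k v) eq know) vl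
... | true  = valid-sound Γ G I roles e w w-new br _ r (knows-update ρ _ (clamp k v) eq know) vr

-- Exclusion steps and their composition

record Entry : Set where
  constructor entry
  field
    codes : List ℕ
    marks : List (Role ℕ)
    tree  : Tree

  graph : Graph (suc (length codes))
  graph = fromCodes codes

  roles : Fin (suc (length codes)) → Role (Fin (suc (length codes)))
  roles = assign marks
    where
    role : Role ℕ → Role (Fin (suc (length codes)))
    role keep     = keep
    role free     = free
    role (copy b) = copy (clamp _ b)
    assign : ∀ {m} → List (Role ℕ) → Fin m → Role (Fin (suc (length codes)))
    -- Vertices beyond the listed marks are kept.
    assign []       _       = keep
    assign (r ∷ rs) zero    = role r
    assign (r ∷ rs) (suc i) = assign rs i

  Entailed : List AnyGraph → Set
  Entailed Γ = Recolouring.Reducible graph roles × Valid Γ graph roles (replicate _ nothing) tree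

  entailed? : ∀ Γ → Dec (Entailed Γ)
  entailed? Γ = Recolouring.reducible? graph roles ×-dec valid? Γ graph roles (replicate _ nothing) tree

  entailed-sound : ∀ Γ → Entailed Γ → ∀ {n} (G : Graph n) → Critical G → InducedSub graph G →
                   Any (_⊑ G) Γ
  entailed-sound Γ (red , valid) G crit e with escape G graph roles crit e red
  ... | w , w-new , br = valid-sound Γ G graph roles e w w-new br _ tree
    -- At the root every entry of the row is `nothing`, so there is nothing to verify.
    (λ i b eq → ⊥-elim (nothing≢just (trans (sym (lookup-replicate i nothing)) eq))) valid
    where
    nothing≢just : ∀ {b : Bool} → nothing ≢ just b
    nothing≢just ()

-- Each graph, once excluded, may be cited by later entries; appending it at the end leaves the
-- positions used by `sub` unchanged. The goal is a one-vertex graph, which every nonempty graph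
-- contains.
Derivation : List AnyGraph → List Entry → Set
Derivation Γ []       = Any (λ X → proj₁ X ≡ 1) Γ
Derivation Γ (E ∷ Es) = Entry.Entailed E Γ × Derivation (Γ ∷ʳ (_ , Entry.graph E)) Es

derivation? : ∀ Γ Es → Dec (Derivation Γ Es)
derivation? Γ []       = Any.any? (λ X → proj₁ X ℕ.≟ 1) Γ
derivation? Γ (E ∷ Es) = Entry.entailed? E Γ ×-dec derivation? _ Es

vertex⇒singleton-sub : ∀ {n} (G : Graph n) (H : Graph 1) → Fin n → InducedSub H G
vertex⇒singleton-sub G H v = (λ _ → v) , (λ { {zero} {zero} _ → refl }) ,
  λ { zero zero → trans (Graph.irrefl H zero) (sym (Graph.irrefl G v)) }

critical⇒vertex : ∀ {n} (G : Graph n) → Critical G → Fin n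
critical⇒vertex {zero}  G (¬c , _) = ⊥-elim (¬c ((λ ()) , λ ()))
critical⇒vertex {suc n} G _        = zero

-- The one-vertex graph gives a first hit, and the list is then undone from its end: a hit on the
-- graph appended last is moved by its own entry to an earlier one, until it falls into the initial
-- `Γ`.
derivation-sound : ∀ Γ Es → Derivation Γ Es → ∀ {n} (G : Graph n) → Critical G → Any (_⊑ G) Γ
derivation-sound Γ [] one G crit =
  Any.map (λ { {_ , H} refl → vertex⇒singleton-sub G H (critical⇒vertex G crit) }) one
derivation-sound Γ (E ∷ Es) (entailed , rest) G crit
  with ++⁻ Γ (derivation-sound _ Es rest G crit)
... | inj₁ hit        = hit
... | inj₂ (here hit) = Entry.entailed-sound E Γ entailed G crit hit

-- From checked data to the classification

module Classification (F₁ F₂ : Graph 5) (codes : List (List ℕ)) (Es : List Entry) where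

  size : Fin (length codes) → ℕ
  size i = suc (length (List.lookup codes i))

  member : (i : Fin (length codes)) → Graph (size i)
  member i = fromCodes (List.lookup codes i)

  -- In `sub`, positions 0 and 1 are thus the forbidden graphs, and the critical graphs start at 2.
  obstructions : List AnyGraph
  obstructions = (_ , F₁) ∷ (_ , F₂) ∷ List.map (λ cs → _ , fromCodes cs) codes

  -- Between graphs of equal order an induced embedding is an isomorphism, so the embedding search
  -- also decides that the members are distinct; different orders need no search.
  Checked : Set
  Checked = (∀ i → Certified4Critical (member i) × Free (member i) F₁ × Free (member i) F₂) ×
            (∀ i j → i ≢ j → size i ≡ size j → ¬ InducedSub (member i) (member j)) ×
            Derivation obstructions Es

  checked? : Dec Checked
  checked? =
    (all? λ i → certified4Critical? (member i) ×-dec ¬? (inducedSub? F₁ (member i)) ×-dec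
                ¬? (inducedSub? F₂ (member i))) ×-dec
    (all? λ i → all? λ j → ¬? (i ≟ j) →-dec (size i ℕ.≟ size j) →-dec ¬? (inducedSub? (member i) (member j))) ×-dec
    derivation? obstructions Es

  classification : Checked → ExactlyUpToIso (length codes)
                     (λ G → VertexCritical 4 G × Free G F₁ × Free G F₂)
  classification (members , distinct , derivation) =
    (λ i → _ , member i) ,
    (λ i → Certified4Critical⇒VertexCritical (member i) (proj₁ (members i)) , proj₂ (members i)) ,
    (λ i j i≢j iso → distinct i j i≢j (↔⇒≡ (proj₁ iso)) (≅⇒InducedSub (member i) (member j) iso)) ,
    complete
    where
    complete : ∀ {n} (G : Graph n) → VertexCritical 4 G × Free G F₁ × Free G F₂ →
               ∃ λ i → G ≅ member i
    complete G (vc , free₁ , free₂)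
      with derivation-sound obstructions Es derivation G (VertexCritical⇒Critical G vc)
    ... | here s                = ⊥-elim (free₁ s)
    ... | there (here s)        = ⊥-elim (free₂ s)
    -- A listed graph inside G is not 3-colourable, hence by criticality it is all of G.
    ... | there (there s) = Any.index s′ ,
      non3Colorable-sub⇒≅ (member (Any.index s′)) G (proj₁ (proj₂ (proj₁ (members (Any.index s′)))))
        (VertexCritical⇒Critical G vc) (lookup-index s′)
      where s′ = map⁻ s

-- Data for the gem

-- These are K₄, the Moser spindle, and a graph on ten vertices. In the last, two diamonds force
-- each pair of opposite vertices of a 4-cycle to agree in colour; two adjacent vertices, each
-- joined to the ends of a cycle edge, would then both need the third colour.
gemCodes : List (List ℕ)
gemCodes =
  (7 ∷ 3 ∷ 1 ∷ []) ∷
  (22 ∷ 21 ∷ 3 ∷ 2 ∷ 2 ∷ 1 ∷ []) ∷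
  (13 ∷ 6 ∷ 84 ∷ 50 ∷ 19 ∷ 3 ∷ 2 ∷ 2 ∷ 1 ∷ []) ∷ []

-- The three critical graphs occupy positions 2 to 4, so the first entry becomes `sub 5`. The order
-- is: graphs containing a 5-cycle, the diamond, the triangle, then paths down to one vertex.
gemEntries : List Entry
gemEntries =
  entry (39 ∷ 20 ∷ 19 ∷ 9 ∷ 1 ∷ 1 ∷ 1 ∷ []) (keep ∷ keep ∷ keep ∷ keep ∷ keep ∷ keep ∷ keep ∷ copy 0 ∷ [])
    (ask 7
      stop
      (ask 0
        (ask 3
          (ask 4
            (ask 5
              (sub 0 (0 ∷ 8 ∷ 4 ∷ 5 ∷ 6 ∷ []))
              (sub 0 (0 ∷ 6 ∷ 5 ∷ 4 ∷ 1 ∷ [])))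
            (ask 6
              (sub 0 (0 ∷ 5 ∷ 4 ∷ 1 ∷ 7 ∷ []))
              (ask 1
                (sub 0 (0 ∷ 8 ∷ 4 ∷ 1 ∷ 2 ∷ []))
                (sub 1 (8 ∷ 0 ∷ 2 ∷ 1 ∷ 7 ∷ [])))))
          (ask 2
            (sub 1 (0 ∷ 8 ∷ 3 ∷ 1 ∷ 4 ∷ []))
            (sub 2 (3 ∷ 4 ∷ 8 ∷ 0 ∷ []))))
        stop)) ∷
  entry (73 ∷ 20 ∷ 19 ∷ 9 ∷ 1 ∷ 1 ∷ 1 ∷ []) (keep ∷ keep ∷ keep ∷ keep ∷ keep ∷ copy 1 ∷ [])
    (ask 5
      stop
      (ask 1
        (ask 7
          (ask 6
            (ask 3
              (sub 0 (0 ∷ 6 ∷ 7 ∷ 8 ∷ 4 ∷ []))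
              (sub 0 (0 ∷ 4 ∷ 8 ∷ 7 ∷ 2 ∷ [])))
            (ask 4
              (ask 3
                (sub 0 (0 ∷ 7 ∷ 8 ∷ 4 ∷ 5 ∷ []))
                (ask 2
                  (sub 0 (0 ∷ 7 ∷ 8 ∷ 3 ∷ 5 ∷ []))
                  (sub 5 (0 ∷ 6 ∷ 3 ∷ 4 ∷ 5 ∷ 2 ∷ 7 ∷ 8 ∷ []))))
              (ask 3
                (ask 2
                  (sub 3 (3 ∷ 6 ∷ 5 ∷ 4 ∷ 0 ∷ 8 ∷ 7 ∷ []))
                  (sub 0 (4 ∷ 3 ∷ 0 ∷ 7 ∷ 2 ∷ [])))
                (sub 1 (7 ∷ 6 ∷ 5 ∷ 4 ∷ 0 ∷ [])))))
          (ask 4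
            (sub 0 (8 ∷ 0 ∷ 6 ∷ 5 ∷ 2 ∷ []))
            (ask 0
              (sub 0 (6 ∷ 0 ∷ 8 ∷ 1 ∷ 2 ∷ []))
              (sub 1 (8 ∷ 0 ∷ 5 ∷ 2 ∷ 1 ∷ [])))))
        stop)) ∷
  entry (20 ∷ 19 ∷ 9 ∷ 1 ∷ 1 ∷ 1 ∷ []) (keep ∷ keep ∷ keep ∷ keep ∷ copy 0 ∷ [])
    (ask 0
      (ask 4
        stop
        (ask 3
          (ask 6
            (ask 2
              (sub 0 (0 ∷ 5 ∷ 4 ∷ 3 ∷ 7 ∷ []))
              (ask 5
                (sub 0 (0 ∷ 3 ∷ 7 ∷ 6 ∷ 1 ∷ []))
                (ask 1
                  (sub 0 (0 ∷ 6 ∷ 7 ∷ 2 ∷ 4 ∷ []))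
                  (sub 5 (0 ∷ 5 ∷ 2 ∷ 3 ∷ 4 ∷ 1 ∷ 6 ∷ 7 ∷ [])))))
            (sub 0 (7 ∷ 0 ∷ 5 ∷ 4 ∷ 1 ∷ [])))
          (ask 2
            (ask 1
              (ask 6
                (ask 5
                  (sub 0 (0 ∷ 5 ∷ 6 ∷ 7 ∷ 3 ∷ []))
                  (sub 3 (2 ∷ 5 ∷ 4 ∷ 3 ∷ 0 ∷ 7 ∷ 6 ∷ [])))
                (ask 5
                  (sub 6 (0 ∷ 5 ∷ 2 ∷ 3 ∷ 4 ∷ 1 ∷ 6 ∷ 7 ∷ []))
                  (sub 1 (7 ∷ 6 ∷ 5 ∷ 4 ∷ 0 ∷ []))))
              (sub 1 (5 ∷ 0 ∷ 2 ∷ 3 ∷ 4 ∷ [])))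
            (ask 5
              (sub 0 (3 ∷ 0 ∷ 5 ∷ 6 ∷ 1 ∷ []))
              (sub 1 (6 ∷ 5 ∷ 4 ∷ 3 ∷ 0 ∷ []))))))
      stop) ∷
  entry (47 ∷ 88 ∷ 52 ∷ 19 ∷ 9 ∷ 1 ∷ 1 ∷ 1 ∷ []) (keep ∷ keep ∷ keep ∷ keep ∷ keep ∷ copy 8 ∷ [])
    (ask 5
      stop
      (ask 8
        (ask 4
          (ask 7
            (sub 0 (0 ∷ 6 ∷ 5 ∷ 9 ∷ 8 ∷ []))
            (ask 3
              (ask 6
                (sub 7 (7 ∷ 4 ∷ 5 ∷ 6 ∷ 0 ∷ 8 ∷ 9 ∷ []))
                (sub 3 (4 ∷ 7 ∷ 6 ∷ 5 ∷ 0 ∷ 9 ∷ 8 ∷ [])))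
              (sub 1 (0 ∷ 6 ∷ 5 ∷ 9 ∷ 4 ∷ []))))
          (ask 3
            (sub 1 (0 ∷ 6 ∷ 4 ∷ 9 ∷ 5 ∷ []))
            (sub 2 (4 ∷ 5 ∷ 6 ∷ 0 ∷ []))))
        stop)) ∷
  entry (3 ∷ 88 ∷ 52 ∷ 19 ∷ 9 ∷ 1 ∷ 1 ∷ 1 ∷ []) (copy 8 ∷ [])
    (ask 0
      stop
      (ask 8
        (ask 7
          (ask 6
            (ask 1
              (sub 0 (0 ∷ 1 ∷ 2 ∷ 9 ∷ 8 ∷ []))
              (ask 5
                (ask 4
                  (ask 3
                    (ask 2
                      (sub 0 (0 ∷ 2 ∷ 7 ∷ 8 ∷ 3 ∷ []))
                      (sub 4 (4 ∷ 5 ∷ 1 ∷ 9 ∷ 6 ∷ 2 ∷ 7 ∷ 0 ∷ 8 ∷ 3 ∷ [])))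
                    (sub 0 (0 ∷ 4 ∷ 9 ∷ 8 ∷ 7 ∷ [])))
                  (sub 0 (0 ∷ 5 ∷ 9 ∷ 8 ∷ 7 ∷ [])))
                (sub 0 (0 ∷ 6 ∷ 7 ∷ 8 ∷ 9 ∷ []))))
            (sub 0 (1 ∷ 0 ∷ 7 ∷ 8 ∷ 9 ∷ [])))
          (ask 2
            (ask 4
              (sub 0 (0 ∷ 1 ∷ 3 ∷ 9 ∷ 5 ∷ []))
              (ask 3
                (sub 0 (0 ∷ 1 ∷ 3 ∷ 9 ∷ 4 ∷ []))
                (ask 5
                  (sub 7 (1 ∷ 4 ∷ 5 ∷ 0 ∷ 8 ∷ 3 ∷ 6 ∷ []))
                  (sub 2 (4 ∷ 5 ∷ 6 ∷ 0 ∷ [])))))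
            (sub 1 (1 ∷ 0 ∷ 8 ∷ 9 ∷ 3 ∷ []))))
        stop)) ∷
  entry (88 ∷ 52 ∷ 19 ∷ 9 ∷ 1 ∷ 1 ∷ 1 ∷ []) (keep ∷ free ∷ [])
    (ask 1
      stop
      (ask 7
        (ask 5
          (ask 0
            (sub 0 (0 ∷ 2 ∷ 8 ∷ 1 ∷ 6 ∷ []))
            (ask 4
              (ask 6
                (ask 3
                  (ask 2
                    (sub 9 (0 ∷ 1 ∷ 2 ∷ 3 ∷ 4 ∷ 5 ∷ 6 ∷ 7 ∷ 8 ∷ []))
                    (sub 0 (0 ∷ 3 ∷ 8 ∷ 7 ∷ 6 ∷ [])))
                  (sub 0 (0 ∷ 4 ∷ 8 ∷ 7 ∷ 6 ∷ [])))
                (ask 3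
                  (sub 0 (0 ∷ 7 ∷ 8 ∷ 4 ∷ 5 ∷ []))
                  (ask 2
                    (sub 0 (0 ∷ 7 ∷ 8 ∷ 3 ∷ 5 ∷ []))
                    (sub 8 (8 ∷ 2 ∷ 1 ∷ 3 ∷ 4 ∷ 0 ∷ 7 ∷ 6 ∷ 5 ∷ [])))))
              (sub 1 (2 ∷ 0 ∷ 1 ∷ 6 ∷ 5 ∷ []))))
          (ask 6
            (ask 3
              (sub 0 (0 ∷ 6 ∷ 7 ∷ 8 ∷ 4 ∷ []))
              (ask 2
                (sub 0 (0 ∷ 6 ∷ 7 ∷ 8 ∷ 3 ∷ []))
                (ask 4
                  (ask 0
                    (sub 7 (1 ∷ 3 ∷ 4 ∷ 8 ∷ 7 ∷ 6 ∷ 0 ∷ []))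
                    (sub 8 (5 ∷ 1 ∷ 2 ∷ 3 ∷ 4 ∷ 0 ∷ 6 ∷ 7 ∷ 8 ∷ [])))
                  (sub 2 (3 ∷ 4 ∷ 5 ∷ 0 ∷ [])))))
            (sub 1 (6 ∷ 0 ∷ 2 ∷ 8 ∷ 7 ∷ []))))
        (ask 6
          (ask 3
            (ask 2
              (ask 4
                (ask 5
                  (sub 0 (0 ∷ 8 ∷ 7 ∷ 6 ∷ 5 ∷ []))
                  (sub 7 (7 ∷ 3 ∷ 4 ∷ 8 ∷ 0 ∷ 6 ∷ 5 ∷ [])))
                (sub 1 (5 ∷ 0 ∷ 8 ∷ 7 ∷ 2 ∷ [])))
              (sub 0 (7 ∷ 2 ∷ 0 ∷ 3 ∷ 4 ∷ [])))
            (sub 1 (4 ∷ 0 ∷ 2 ∷ 7 ∷ 8 ∷ [])))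
          (sub 2 (2 ∷ 7 ∷ 8 ∷ 0 ∷ []))))) ∷
  entry (52 ∷ 19 ∷ 9 ∷ 1 ∷ 1 ∷ 1 ∷ []) (keep ∷ keep ∷ keep ∷ keep ∷ copy 0 ∷ [])
    (ask 4
      stop
      (ask 0
        (ask 6
          (ask 2
            (ask 3
              (sub 0 (0 ∷ 5 ∷ 4 ∷ 3 ∷ 7 ∷ []))
              (ask 1
                (ask 5
                  (sub 0 (0 ∷ 5 ∷ 6 ∷ 7 ∷ 3 ∷ []))
                  (sub 3 (2 ∷ 5 ∷ 4 ∷ 3 ∷ 0 ∷ 7 ∷ 6 ∷ [])))
                (sub 0 (5 ∷ 0 ∷ 2 ∷ 7 ∷ 1 ∷ []))))
            (sub 0 (5 ∷ 0 ∷ 3 ∷ 7 ∷ 1 ∷ [])))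
          (ask 5
            (ask 2
              (ask 1
                (ask 3
                  (sub 7 (6 ∷ 2 ∷ 3 ∷ 7 ∷ 0 ∷ 5 ∷ 4 ∷ []))
                  (sub 10 (1 ∷ 0 ∷ 2 ∷ 3 ∷ 7 ∷ 6 ∷ 5 ∷ 4 ∷ [])))
                (sub 0 (2 ∷ 0 ∷ 5 ∷ 6 ∷ 1 ∷ [])))
              (sub 0 (3 ∷ 0 ∷ 5 ∷ 6 ∷ 1 ∷ [])))
            (sub 1 (5 ∷ 0 ∷ 7 ∷ 1 ∷ 6 ∷ []))))
        stop)) ∷
  entry (19 ∷ 9 ∷ 1 ∷ 1 ∷ 1 ∷ []) (keep ∷ keep ∷ keep ∷ copy 0 ∷ copy 1 ∷ [])
    (ask 4
      (ask 3
        stop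
        (ask 0
          (ask 1
            (ask 5
              (sub 0 (0 ∷ 4 ∷ 5 ∷ 6 ∷ 2 ∷ []))
              (ask 2
                (sub 7 (5 ∷ 1 ∷ 2 ∷ 6 ∷ 0 ∷ 4 ∷ 3 ∷ []))
                (sub 11 (0 ∷ 1 ∷ 2 ∷ 6 ∷ 5 ∷ 4 ∷ 3 ∷ []))))
            (sub 0 (5 ∷ 4 ∷ 0 ∷ 2 ∷ 1 ∷ [])))
          stop))
      (ask 1
        (ask 3
          (ask 0
            (ask 2
              (sub 0 (0 ∷ 5 ∷ 4 ∷ 3 ∷ 2 ∷ []))
              (ask 5
                (sub 7 (4 ∷ 1 ∷ 2 ∷ 3 ∷ 0 ∷ 5 ∷ 6 ∷ []))
                (sub 11 (0 ∷ 1 ∷ 2 ∷ 3 ∷ 4 ∷ 5 ∷ 6 ∷ []))))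
            (sub 0 (4 ∷ 5 ∷ 0 ∷ 1 ∷ 2 ∷ [])))
          (ask 5
            (ask 2
              (sub 0 (0 ∷ 5 ∷ 6 ∷ 2 ∷ 3 ∷ []))
              (ask 0
                (sub 3 (1 ∷ 4 ∷ 3 ∷ 2 ∷ 0 ∷ 6 ∷ 5 ∷ []))
                (sub 1 (0 ∷ 3 ∷ 2 ∷ 6 ∷ 1 ∷ []))))
            (ask 0
              (ask 2
                (sub 3 (1 ∷ 5 ∷ 6 ∷ 2 ∷ 0 ∷ 3 ∷ 4 ∷ []))
                (sub 1 (6 ∷ 5 ∷ 4 ∷ 3 ∷ 0 ∷ [])))
              (sub 1 (5 ∷ 0 ∷ 1 ∷ 2 ∷ 6 ∷ [])))))
        (ask 0
          (ask 5
            (ask 2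
              (sub 0 (0 ∷ 5 ∷ 6 ∷ 1 ∷ 3 ∷ []))
              (sub 1 (0 ∷ 3 ∷ 1 ∷ 6 ∷ 2 ∷ [])))
            (sub 1 (5 ∷ 0 ∷ 2 ∷ 1 ∷ 6 ∷ [])))
          stop))) ∷
  entry (172 ∷ 92 ∷ 75 ∷ 26 ∷ 20 ∷ 9 ∷ 1 ∷ 1 ∷ 1 ∷ []) (keep ∷ keep ∷ keep ∷ keep ∷ keep ∷ keep ∷ keep ∷ copy 0 ∷ [])
    (ask 7
      stop
      (ask 9
        (ask 5
          (ask 8
            (sub 0 (0 ∷ 8 ∷ 9 ∷ 10 ∷ 6 ∷ []))
            (ask 6
              (sub 0 (0 ∷ 9 ∷ 10 ∷ 6 ∷ 7 ∷ []))
              (sub 12 (8 ∷ 0 ∷ 7 ∷ 6 ∷ 10 ∷ 9 ∷ []))))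
          (ask 2
            (sub 0 (8 ∷ 0 ∷ 6 ∷ 10 ∷ 3 ∷ []))
            (ask 4
              (ask 0
                (sub 0 (0 ∷ 6 ∷ 10 ∷ 5 ∷ 1 ∷ []))
                stop)
              (sub 1 (8 ∷ 0 ∷ 3 ∷ 10 ∷ 5 ∷ [])))))
        (ask 3
          (ask 0
            (sub 0 (10 ∷ 0 ∷ 8 ∷ 4 ∷ 1 ∷ []))
            stop)
          (ask 8
            (ask 0
              (sub 1 (0 ∷ 8 ∷ 9 ∷ 1 ∷ 4 ∷ []))
              stop)
            (sub 2 (4 ∷ 8 ∷ 9 ∷ 0 ∷ [])))))) ∷
  entry (92 ∷ 75 ∷ 26 ∷ 20 ∷ 9 ∷ 1 ∷ 1 ∷ 1 ∷ []) (keep ∷ keep ∷ keep ∷ free ∷ keep ∷ keep ∷ keep ∷ keep ∷ free ∷ [])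
    (ask 8
      (ask 3
        stop
        (ask 2
          (ask 4
            (sub 0 (0 ∷ 4 ∷ 9 ∷ 5 ∷ 3 ∷ []))
            (ask 7
              (sub 0 (0 ∷ 4 ∷ 9 ∷ 8 ∷ 3 ∷ []))
              (ask 6
                (ask 0
                  (ask 5
                    (ask 1
                      (sub 0 (0 ∷ 8 ∷ 9 ∷ 2 ∷ 6 ∷ []))
                      (sub 13 (9 ∷ 1 ∷ 3 ∷ 2 ∷ 8 ∷ 6 ∷ 5 ∷ 0 ∷ 4 ∷ 7 ∷ [])))
                    (ask 1
                      (sub 13 (1 ∷ 9 ∷ 7 ∷ 6 ∷ 8 ∷ 2 ∷ 4 ∷ 0 ∷ 5 ∷ 3 ∷ []))
                      (sub 1 (6 ∷ 0 ∷ 4 ∷ 9 ∷ 2 ∷ []))))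
                  (sub 12 (1 ∷ 0 ∷ 4 ∷ 7 ∷ 3 ∷ 5 ∷ [])))
                (sub 1 (4 ∷ 0 ∷ 8 ∷ 3 ∷ 7 ∷ [])))))
          (ask 1
            (ask 0
              (ask 5
                (sub 0 (0 ∷ 3 ∷ 2 ∷ 6 ∷ 1 ∷ []))
                (ask 7
                  (sub 0 (0 ∷ 6 ∷ 2 ∷ 9 ∷ 8 ∷ []))
                  (ask 6
                    (ask 4
                      (sub 13 (7 ∷ 1 ∷ 2 ∷ 3 ∷ 4 ∷ 5 ∷ 6 ∷ 0 ∷ 8 ∷ 9 ∷ []))
                      (sub 1 (5 ∷ 0 ∷ 8 ∷ 7 ∷ 3 ∷ [])))
                    (sub 2 (3 ∷ 7 ∷ 8 ∷ 0 ∷ [])))))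
              (sub 0 (1 ∷ 0 ∷ 3 ∷ 2 ∷ 9 ∷ [])))
            (sub 1 (3 ∷ 0 ∷ 4 ∷ 9 ∷ 2 ∷ [])))))
      (ask 6
        (ask 5
          (ask 3
            (sub 0 (0 ∷ 9 ∷ 4 ∷ 7 ∷ 6 ∷ []))
            (ask 4
              (sub 0 (0 ∷ 9 ∷ 5 ∷ 6 ∷ 7 ∷ []))
              (sub 12 (9 ∷ 0 ∷ 4 ∷ 7 ∷ 6 ∷ 5 ∷ []))))
          (ask 2
            (sub 0 (9 ∷ 0 ∷ 6 ∷ 7 ∷ 3 ∷ []))
            (ask 7
              (ask 1
                (ask 4
                  (ask 3
                    (ask 0
                      (sub 0 (0 ∷ 3 ∷ 8 ∷ 1 ∷ 4 ∷ []))
                      (sub 13 (5 ∷ 2 ∷ 8 ∷ 1 ∷ 3 ∷ 4 ∷ 9 ∷ 0 ∷ 6 ∷ 7 ∷ [])))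
                    (ask 0
                      (sub 13 (2 ∷ 5 ∷ 7 ∷ 4 ∷ 3 ∷ 1 ∷ 6 ∷ 0 ∷ 9 ∷ 8 ∷ []))
                      (sub 1 (4 ∷ 0 ∷ 6 ∷ 5 ∷ 1 ∷ []))))
                  (sub 12 (5 ∷ 0 ∷ 6 ∷ 7 ∷ 8 ∷ 9 ∷ [])))
                (sub 12 (2 ∷ 0 ∷ 6 ∷ 7 ∷ 8 ∷ 9 ∷ [])))
              (sub 1 (9 ∷ 0 ∷ 3 ∷ 7 ∷ 8 ∷ [])))))
        (ask 5
          (ask 0
            (sub 0 (9 ∷ 0 ∷ 7 ∷ 6 ∷ 1 ∷ []))
            (ask 4
              (ask 3
                (ask 7
                  (ask 2
                    (ask 1
                      (sub 0 (0 ∷ 1 ∷ 8 ∷ 3 ∷ 2 ∷ []))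
                      (sub 13 (4 ∷ 8 ∷ 6 ∷ 2 ∷ 1 ∷ 3 ∷ 7 ∷ 0 ∷ 9 ∷ 5 ∷ [])))
                    (ask 1
                      (sub 13 (8 ∷ 4 ∷ 5 ∷ 3 ∷ 1 ∷ 2 ∷ 9 ∷ 0 ∷ 7 ∷ 6 ∷ []))
                      (sub 1 (3 ∷ 0 ∷ 9 ∷ 4 ∷ 2 ∷ []))))
                  (sub 12 (8 ∷ 0 ∷ 7 ∷ 6 ∷ 5 ∷ 9 ∷ [])))
                (sub 12 (4 ∷ 0 ∷ 7 ∷ 6 ∷ 5 ∷ 9 ∷ [])))
              (sub 1 (9 ∷ 0 ∷ 1 ∷ 6 ∷ 5 ∷ []))))
          (ask 7
            (ask 2
              (sub 0 (6 ∷ 0 ∷ 9 ∷ 8 ∷ 3 ∷ []))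
              (sub 1 (6 ∷ 0 ∷ 3 ∷ 8 ∷ 7 ∷ [])))
            (sub 1 (9 ∷ 8 ∷ 7 ∷ 6 ∷ 0 ∷ [])))))) ∷
  entry (75 ∷ 26 ∷ 20 ∷ 9 ∷ 1 ∷ 1 ∷ 1 ∷ []) (keep ∷ keep ∷ keep ∷ keep ∷ copy 1 ∷ [])
    (ask 4
      stop
      (ask 1
        (ask 6
          (ask 7
            (ask 3
              (sub 0 (0 ∷ 5 ∷ 4 ∷ 8 ∷ 7 ∷ []))
              (ask 5
                (sub 0 (0 ∷ 5 ∷ 6 ∷ 7 ∷ 8 ∷ []))
                (sub 12 (5 ∷ 0 ∷ 4 ∷ 8 ∷ 7 ∷ 6 ∷ []))))
            (sub 0 (5 ∷ 0 ∷ 8 ∷ 7 ∷ 2 ∷ [])))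
          (ask 5
            (ask 7
              (ask 2
                (sub 0 (0 ∷ 5 ∷ 6 ∷ 3 ∷ 8 ∷ []))
                (ask 3
                  (sub 0 (0 ∷ 3 ∷ 8 ∷ 4 ∷ 2 ∷ []))
                  (ask 0
                    (sub 14 (8 ∷ 5 ∷ 6 ∷ 4 ∷ 3 ∷ 1 ∷ 2 ∷ 7 ∷ 0 ∷ []))
                    (sub 1 (5 ∷ 0 ∷ 3 ∷ 8 ∷ 1 ∷ [])))))
              (sub 0 (8 ∷ 0 ∷ 5 ∷ 6 ∷ 2 ∷ [])))
            (sub 1 (5 ∷ 0 ∷ 7 ∷ 2 ∷ 6 ∷ []))))
        stop)) ∷
  entry (26 ∷ 20 ∷ 9 ∷ 1 ∷ 1 ∷ 1 ∷ []) (keep ∷ keep ∷ keep ∷ copy 0 ∷ [])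
    (ask 3
      stop
      (ask 0
        (ask 4
          (ask 6
            (ask 1
              (sub 0 (0 ∷ 4 ∷ 5 ∷ 2 ∷ 7 ∷ []))
              (ask 5
                (sub 0 (0 ∷ 4 ∷ 5 ∷ 6 ∷ 7 ∷ []))
                (ask 2
                  (sub 0 (0 ∷ 2 ∷ 7 ∷ 3 ∷ 1 ∷ []))
                  (sub 15 (6 ∷ 0 ∷ 1 ∷ 2 ∷ 7 ∷ 3 ∷ 4 ∷ 5 ∷ [])))))
            (sub 0 (7 ∷ 0 ∷ 4 ∷ 5 ∷ 1 ∷ [])))
          (ask 5
            (ask 6
              (ask 2
                (sub 0 (0 ∷ 5 ∷ 6 ∷ 7 ∷ 3 ∷ []))
                (sub 12 (4 ∷ 0 ∷ 3 ∷ 7 ∷ 6 ∷ 5 ∷ [])))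
              (sub 0 (4 ∷ 0 ∷ 7 ∷ 6 ∷ 1 ∷ [])))
            (sub 1 (4 ∷ 0 ∷ 6 ∷ 1 ∷ 5 ∷ []))))
        stop)) ∷
  entry (20 ∷ 9 ∷ 1 ∷ 1 ∷ 1 ∷ []) (keep ∷ keep ∷ keep ∷ keep ∷ copy 0 ∷ [])
    (ask 4
      stop
      (ask 0
        (ask 5
          (ask 2
            (ask 1
              (sub 0 (0 ∷ 5 ∷ 6 ∷ 2 ∷ 3 ∷ []))
              (ask 3
                (sub 0 (0 ∷ 2 ∷ 6 ∷ 1 ∷ 4 ∷ []))
                (sub 16 (5 ∷ 3 ∷ 6 ∷ 1 ∷ 4 ∷ 0 ∷ 2 ∷ []))))
            (sub 0 (3 ∷ 0 ∷ 5 ∷ 6 ∷ 1 ∷ [])))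
          (ask 3
            (ask 2
              (sub 0 (0 ∷ 6 ∷ 1 ∷ 4 ∷ 3 ∷ []))
              (ask 1
                (sub 16 (5 ∷ 2 ∷ 4 ∷ 1 ∷ 6 ∷ 0 ∷ 3 ∷ []))
                (sub 0 (2 ∷ 0 ∷ 5 ∷ 4 ∷ 1 ∷ []))))
            (ask 2
              (ask 1
                (sub 12 (5 ∷ 0 ∷ 4 ∷ 3 ∷ 2 ∷ 6 ∷ []))
                (sub 1 (4 ∷ 5 ∷ 6 ∷ 2 ∷ 0 ∷ [])))
              (sub 1 (6 ∷ 5 ∷ 4 ∷ 3 ∷ 0 ∷ [])))))
        stop)) ∷
  entry (26 ∷ 11 ∷ 9 ∷ 1 ∷ 1 ∷ 1 ∷ []) (keep ∷ keep ∷ keep ∷ keep ∷ keep ∷ keep ∷ free ∷ [])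
    (ask 6
      stop
      (ask 4
        (ask 3
          (ask 5
            (sub 0 (0 ∷ 7 ∷ 6 ∷ 5 ∷ 4 ∷ []))
            (ask 2
              (sub 0 (0 ∷ 7 ∷ 3 ∷ 4 ∷ 5 ∷ []))
              (sub 12 (7 ∷ 0 ∷ 3 ∷ 4 ∷ 5 ∷ 6 ∷ []))))
          (ask 0
            (sub 0 (7 ∷ 0 ∷ 4 ∷ 5 ∷ 1 ∷ []))
            (ask 5
              (ask 2
                (sub 17 (3 ∷ 6 ∷ 5 ∷ 4 ∷ 0 ∷ 7 ∷ []))
                (sub 12 (3 ∷ 0 ∷ 4 ∷ 5 ∷ 6 ∷ 7 ∷ [])))
              (sub 1 (7 ∷ 0 ∷ 1 ∷ 5 ∷ 6 ∷ [])))))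
        (ask 2
          (ask 1
            (sub 0 (5 ∷ 0 ∷ 7 ∷ 3 ∷ 2 ∷ []))
            (ask 3
              (ask 5
                (sub 17 (6 ∷ 3 ∷ 4 ∷ 5 ∷ 0 ∷ 7 ∷ []))
                (sub 12 (6 ∷ 0 ∷ 5 ∷ 4 ∷ 3 ∷ 7 ∷ [])))
              (sub 1 (5 ∷ 0 ∷ 2 ∷ 3 ∷ 4 ∷ []))))
          (ask 3
            (ask 1
              (sub 0 (7 ∷ 0 ∷ 5 ∷ 4 ∷ 2 ∷ []))
              (sub 1 (7 ∷ 0 ∷ 2 ∷ 4 ∷ 3 ∷ [])))
            (sub 1 (7 ∷ 3 ∷ 4 ∷ 5 ∷ 0 ∷ [])))))) ∷
  entry (11 ∷ 9 ∷ 1 ∷ 1 ∷ 1 ∷ []) (keep ∷ keep ∷ keep ∷ keep ∷ keep ∷ free ∷ [])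
    (ask 5
      stop
      (ask 2
        (ask 3
          (ask 4
            (sub 0 (0 ∷ 6 ∷ 5 ∷ 4 ∷ 3 ∷ []))
            (ask 1
              (sub 0 (0 ∷ 6 ∷ 2 ∷ 3 ∷ 4 ∷ []))
              (sub 12 (6 ∷ 0 ∷ 2 ∷ 3 ∷ 4 ∷ 5 ∷ []))))
          (ask 0
            (sub 0 (6 ∷ 0 ∷ 4 ∷ 3 ∷ 1 ∷ []))
            (ask 1
              (ask 4
                (sub 17 (5 ∷ 2 ∷ 3 ∷ 4 ∷ 0 ∷ 6 ∷ []))
                (sub 12 (5 ∷ 0 ∷ 4 ∷ 3 ∷ 2 ∷ 6 ∷ [])))
              (sub 1 (6 ∷ 0 ∷ 1 ∷ 3 ∷ 2 ∷ [])))))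
        (ask 1
          (ask 3
            (ask 4
              (sub 17 (2 ∷ 5 ∷ 4 ∷ 3 ∷ 0 ∷ 6 ∷ []))
              (ask 0
                (sub 18 (1 ∷ 0 ∷ 5 ∷ 6 ∷ 2 ∷ 3 ∷ 4 ∷ []))
                (sub 1 (5 ∷ 0 ∷ 3 ∷ 2 ∷ 1 ∷ []))))
            (ask 0
              (sub 0 (4 ∷ 0 ∷ 6 ∷ 2 ∷ 1 ∷ []))
              (sub 1 (4 ∷ 0 ∷ 1 ∷ 2 ∷ 3 ∷ []))))
          (ask 0
            (sub 1 (6 ∷ 0 ∷ 3 ∷ 1 ∷ 2 ∷ []))
            (sub 2 (1 ∷ 2 ∷ 3 ∷ 0 ∷ [])))))) ∷
  -- The 5-cycle, formed by the five oldest vertices in every entry above. A vertex of degree 2 in I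
  -- can always be coloured last, so it may be `free`.
  entry (9 ∷ 1 ∷ 1 ∷ 1 ∷ []) (keep ∷ keep ∷ keep ∷ keep ∷ free ∷ [])
    (ask 4
      stop
      (ask 2
        (ask 1
          (ask 3
            (sub 0 (0 ∷ 5 ∷ 4 ∷ 3 ∷ 2 ∷ []))
            (ask 0
              (sub 0 (0 ∷ 5 ∷ 1 ∷ 2 ∷ 3 ∷ []))
              (sub 12 (5 ∷ 0 ∷ 1 ∷ 2 ∷ 3 ∷ 4 ∷ []))))
          (ask 3
            (ask 0
              (sub 17 (1 ∷ 4 ∷ 3 ∷ 2 ∷ 0 ∷ 5 ∷ []))
              (sub 12 (1 ∷ 0 ∷ 2 ∷ 3 ∷ 4 ∷ 5 ∷ [])))
            (ask 0
              (sub 19 (0 ∷ 4 ∷ 5 ∷ 1 ∷ 2 ∷ 3 ∷ []))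
              (sub 1 (4 ∷ 5 ∷ 1 ∷ 2 ∷ 0 ∷ [])))))
        (ask 3
          (ask 1
            (ask 0
              (sub 17 (4 ∷ 1 ∷ 2 ∷ 3 ∷ 0 ∷ 5 ∷ []))
              (sub 19 (0 ∷ 5 ∷ 1 ∷ 2 ∷ 3 ∷ 4 ∷ [])))
            (ask 0
              (sub 19 (0 ∷ 3 ∷ 2 ∷ 1 ∷ 5 ∷ 4 ∷ []))
              (sub 1 (5 ∷ 1 ∷ 2 ∷ 3 ∷ 0 ∷ []))))
          (ask 1
            (ask 0
              (sub 12 (4 ∷ 0 ∷ 3 ∷ 2 ∷ 1 ∷ 5 ∷ []))
              (sub 1 (3 ∷ 4 ∷ 5 ∷ 1 ∷ 0 ∷ [])))
            (sub 1 (5 ∷ 4 ∷ 3 ∷ 2 ∷ 0 ∷ [])))))) ∷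
  entry (1 ∷ 5 ∷ 3 ∷ 1 ∷ []) (keep ∷ keep ∷ keep ∷ copy 1 ∷ [])
    (ask 3
      stop
      (ask 1
        (ask 4
          (ask 0
            (sub 0 (0 ∷ 4 ∷ 5 ∷ 2 ∷ 1 ∷ []))
            (sub 20 (1 ∷ 2 ∷ 5 ∷ 4 ∷ 0 ∷ [])))
          (ask 2
            (sub 1 (0 ∷ 4 ∷ 3 ∷ 2 ∷ 5 ∷ []))
            (sub 2 (3 ∷ 4 ∷ 5 ∷ 0 ∷ []))))
        stop)) ∷
  -- The diamond. Its two vertices of degree 2 have the same neighbours, so one may take the colour
  -- of the other, and some `w` sees only the first. The previous entry is the diamond with a
  -- pendant vertex at one of these two.
  entry (5 ∷ 3 ∷ 1 ∷ []) (keep ∷ keep ∷ copy 0 ∷ [])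
    (ask 2
      stop
      (ask 0
        (ask 3
          (ask 1
            (sub 21 (0 ∷ 3 ∷ 2 ∷ 1 ∷ 4 ∷ []))
            (sub 1 (0 ∷ 3 ∷ 4 ∷ 1 ∷ 2 ∷ [])))
          (ask 1
            (sub 1 (0 ∷ 3 ∷ 2 ∷ 1 ∷ 4 ∷ []))
            (sub 2 (2 ∷ 3 ∷ 4 ∷ 0 ∷ []))))
        stop)) ∷
  -- Extensions of the triangle: the house with one more vertex, the house, the bull with one more
  -- vertex, the bull, and the paw.
  entry (19 ∷ 3 ∷ 2 ∷ 3 ∷ 1 ∷ []) (keep ∷ keep ∷ keep ∷ keep ∷ free ∷ free ∷ [])
    (ask 5
      (ask 4
        stop
        (ask 3
          (ask 1
            (ask 0
              (sub 0 (0 ∷ 5 ∷ 6 ∷ 1 ∷ 2 ∷ []))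
              (sub 20 (1 ∷ 2 ∷ 4 ∷ 5 ∷ 0 ∷ [])))
            (ask 2
              (ask 0
                (sub 20 (2 ∷ 1 ∷ 6 ∷ 5 ∷ 0 ∷ []))
                (sub 22 (3 ∷ 1 ∷ 0 ∷ 2 ∷ [])))
              (sub 22 (2 ∷ 3 ∷ 5 ∷ 0 ∷ []))))
          (sub 22 (6 ∷ 4 ∷ 0 ∷ 5 ∷ []))))
      (ask 4
        (ask 3
          (ask 2
            (ask 1
              (sub 0 (0 ∷ 6 ∷ 5 ∷ 3 ∷ 2 ∷ []))
              (sub 20 (2 ∷ 3 ∷ 5 ∷ 6 ∷ 0 ∷ [])))
            (ask 1
              (sub 20 (3 ∷ 2 ∷ 4 ∷ 6 ∷ 0 ∷ []))
              (ask 0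
                (sub 22 (1 ∷ 2 ∷ 0 ∷ 3 ∷ []))
                (sub 2 (1 ∷ 2 ∷ 3 ∷ 0 ∷ [])))))
          (sub 22 (5 ∷ 4 ∷ 0 ∷ 6 ∷ [])))
        (ask 3
          (sub 22 (4 ∷ 5 ∷ 0 ∷ 6 ∷ []))
          (sub 2 (4 ∷ 5 ∷ 6 ∷ 0 ∷ []))))) ∷
  entry (3 ∷ 2 ∷ 3 ∷ 1 ∷ []) (keep ∷ keep ∷ keep ∷ keep ∷ free ∷ [])
    (ask 4
      stop
      (ask 3
        (ask 2
          (ask 1
            (ask 0
              (sub 0 (0 ∷ 5 ∷ 4 ∷ 2 ∷ 1 ∷ []))
              (sub 20 (1 ∷ 2 ∷ 4 ∷ 5 ∷ 0 ∷ [])))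
            (ask 0
              (sub 20 (2 ∷ 1 ∷ 3 ∷ 5 ∷ 0 ∷ []))
              (sub 23 (5 ∷ 3 ∷ 4 ∷ 1 ∷ 2 ∷ 0 ∷ []))))
          (sub 22 (4 ∷ 3 ∷ 0 ∷ 5 ∷ [])))
        (ask 2
          (sub 22 (3 ∷ 4 ∷ 0 ∷ 5 ∷ []))
          (sub 2 (3 ∷ 4 ∷ 5 ∷ 0 ∷ []))))) ∷
  entry (5 ∷ 2 ∷ 2 ∷ 3 ∷ 1 ∷ []) (keep ∷ free ∷ [])
    (ask 1
      stop
      (ask 3
        (ask 4
          (ask 2
            (sub 0 (0 ∷ 2 ∷ 4 ∷ 5 ∷ 3 ∷ []))
            (sub 20 (2 ∷ 4 ∷ 5 ∷ 3 ∷ 0 ∷ [])))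
          (ask 5
            (sub 24 (2 ∷ 0 ∷ 4 ∷ 5 ∷ 6 ∷ []))
            (sub 22 (4 ∷ 5 ∷ 0 ∷ 6 ∷ []))))
        (ask 0
          (sub 22 (1 ∷ 2 ∷ 0 ∷ 4 ∷ []))
          (sub 2 (1 ∷ 2 ∷ 4 ∷ 0 ∷ []))))) ∷
  entry (2 ∷ 2 ∷ 3 ∷ 1 ∷ []) (keep ∷ free ∷ [])
    (ask 1
      stop
      (ask 3
        (ask 2
          (ask 0
            (sub 0 (0 ∷ 2 ∷ 4 ∷ 3 ∷ 1 ∷ []))
            (sub 20 (1 ∷ 3 ∷ 4 ∷ 2 ∷ 0 ∷ [])))
          (ask 4
            (sub 24 (2 ∷ 0 ∷ 4 ∷ 3 ∷ 5 ∷ []))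
            (sub 22 (4 ∷ 3 ∷ 0 ∷ 5 ∷ []))))
        (ask 2
          (ask 4
            (ask 0
              (sub 25 (2 ∷ 0 ∷ 1 ∷ 4 ∷ 3 ∷ 5 ∷ []))
              (sub 0 (2 ∷ 0 ∷ 1 ∷ 3 ∷ 5 ∷ [])))
            (sub 22 (2 ∷ 4 ∷ 5 ∷ 0 ∷ [])))
          (sub 22 (2 ∷ 4 ∷ 3 ∷ 0 ∷ []))))) ∷
  entry (2 ∷ 3 ∷ 1 ∷ []) (keep ∷ keep ∷ keep ∷ free ∷ [])
    (ask 3
      stop
      (ask 2
        (ask 1
          (ask 0
            (sub 26 (1 ∷ 0 ∷ 3 ∷ 4 ∷ 2 ∷ []))
            (sub 24 (1 ∷ 0 ∷ 3 ∷ 4 ∷ 2 ∷ [])))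
          (sub 22 (3 ∷ 2 ∷ 0 ∷ 4 ∷ [])))
        (ask 1
          (sub 22 (2 ∷ 3 ∷ 0 ∷ 4 ∷ []))
          (sub 2 (2 ∷ 3 ∷ 4 ∷ 0 ∷ []))))) ∷
  entry (3 ∷ 1 ∷ []) (keep ∷ keep ∷ free ∷ [])
    (ask 2
      stop
      (ask 1
        (ask 0
          (sub 27 (0 ∷ 1 ∷ 3 ∷ 2 ∷ []))
          (sub 22 (2 ∷ 1 ∷ 0 ∷ 3 ∷ [])))
        (ask 0
          (sub 22 (1 ∷ 2 ∷ 0 ∷ 3 ∷ []))
          (sub 2 (1 ∷ 2 ∷ 3 ∷ 0 ∷ []))))) ∷
  -- The path P₄. An end copies the vertex at distance two; without triangles the new vertex then
  -- yields P₅ or a 5-cycle.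
  entry (4 ∷ 1 ∷ 1 ∷ []) (keep ∷ copy 3 ∷ [])
    (ask 1
      stop
      (ask 2
        (ask 3
          (ask 0
            (sub 0 (0 ∷ 2 ∷ 3 ∷ 4 ∷ 1 ∷ []))
            (sub 20 (1 ∷ 4 ∷ 3 ∷ 2 ∷ 0 ∷ [])))
          stop)
        (sub 28 (2 ∷ 3 ∷ 0 ∷ [])))) ∷
  entry (1 ∷ 1 ∷ []) (keep ∷ keep ∷ copy 0 ∷ [])
    (ask 2
      stop
      (ask 1
        (ask 0
          (sub 29 (1 ∷ 0 ∷ 3 ∷ 2 ∷ []))
          stop)
        (sub 28 (2 ∷ 3 ∷ 0 ∷ [])))) ∷
  entry (1 ∷ []) (keep ∷ free ∷ [])
    (ask 1
      stop
      (ask 0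
        (sub 30 (1 ∷ 2 ∷ 0 ∷ []))
        (sub 28 (1 ∷ 2 ∷ 0 ∷ [])))) ∷
  -- A single vertex must have a neighbour, which gives the edge excluded just before.
  entry [] (free ∷ [])
    (ask 0
      stop
      (sub 31 (1 ∷ 0 ∷ []))) ∷
  []

-- Data for the complement of P₃ + P₂

-- After K₄ comes the wheel over a 5-cycle. The others are a 5-cycle with two more vertices; the
-- fourth is the Moser spindle, and the fifth adds to it an edge joining its two diamonds.
coP3P2Codes : List (List ℕ)
coP3P2Codes =
  (7 ∷ 3 ∷ 1 ∷ []) ∷
  (31 ∷ 3 ∷ 2 ∷ 2 ∷ 1 ∷ []) ∷
  (30 ∷ 19 ∷ 3 ∷ 2 ∷ 2 ∷ 1 ∷ []) ∷
  (22 ∷ 21 ∷ 3 ∷ 2 ∷ 2 ∷ 1 ∷ []) ∷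
  (23 ∷ 21 ∷ 3 ∷ 2 ∷ 2 ∷ 1 ∷ []) ∷
  (30 ∷ 23 ∷ 3 ∷ 2 ∷ 2 ∷ 1 ∷ []) ∷ []

-- Here the first entry becomes `sub 8`. The order is: graphs containing a 5-cycle, graphs
-- containing a paw, P₄, P₃, the triangle, the edge, one vertex.
coP3P2Entries : List Entry
coP3P2Entries =
  entry (92 ∷ 105 ∷ 11 ∷ 20 ∷ 9 ∷ 1 ∷ 1 ∷ 1 ∷ []) (keep ∷ keep ∷ keep ∷ keep ∷ keep ∷ keep ∷ keep ∷ free ∷ free ∷ [])
    (ask 8
      (ask 7
        stop
        (ask 4
          (ask 5
            (sub 0 (0 ∷ 8 ∷ 9 ∷ 5 ∷ 6 ∷ []))
            (ask 3
              (sub 0 (0 ∷ 6 ∷ 5 ∷ 9 ∷ 4 ∷ []))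
              (ask 2
                (sub 0 (0 ∷ 8 ∷ 9 ∷ 5 ∷ 3 ∷ []))
                (ask 6
                  (sub 1 (4 ∷ 8 ∷ 3 ∷ 0 ∷ 7 ∷ []))
                  (sub 2 (3 ∷ 4 ∷ 7 ∷ 0 ∷ []))))))
          (ask 1
            (ask 3
              (ask 6
                (sub 0 (0 ∷ 5 ∷ 9 ∷ 4 ∷ 7 ∷ []))
                (sub 0 (0 ∷ 7 ∷ 4 ∷ 9 ∷ 2 ∷ [])))
              (ask 5
                (sub 0 (0 ∷ 4 ∷ 9 ∷ 2 ∷ 6 ∷ []))
                (ask 0
                  (sub 1 (6 ∷ 8 ∷ 5 ∷ 0 ∷ 1 ∷ []))
                  (sub 2 (1 ∷ 5 ∷ 6 ∷ 0 ∷ [])))))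
            (sub 1 (8 ∷ 5 ∷ 2 ∷ 0 ∷ 9 ∷ [])))))
      (ask 7
        (ask 6
          (ask 2
            (sub 0 (0 ∷ 9 ∷ 8 ∷ 7 ∷ 3 ∷ []))
            (ask 5
              (sub 0 (0 ∷ 9 ∷ 8 ∷ 7 ∷ 6 ∷ []))
              (ask 0
                (sub 0 (0 ∷ 3 ∷ 7 ∷ 8 ∷ 1 ∷ []))
                (ask 4
                  (sub 1 (6 ∷ 9 ∷ 1 ∷ 0 ∷ 5 ∷ []))
                  (sub 2 (1 ∷ 5 ∷ 6 ∷ 0 ∷ []))))))
          (ask 1
            (ask 0
              (ask 4
                (sub 0 (0 ∷ 7 ∷ 8 ∷ 1 ∷ 5 ∷ []))
                (sub 0 (0 ∷ 5 ∷ 1 ∷ 8 ∷ 2 ∷ [])))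
              (ask 2
                (sub 0 (0 ∷ 1 ∷ 8 ∷ 2 ∷ 3 ∷ []))
                (ask 3
                  (sub 1 (7 ∷ 9 ∷ 3 ∷ 0 ∷ 4 ∷ []))
                  (sub 2 (3 ∷ 4 ∷ 7 ∷ 0 ∷ [])))))
            (sub 1 (9 ∷ 7 ∷ 2 ∷ 0 ∷ 8 ∷ []))))
        (ask 1
          (ask 2
            (ask 5
              (ask 3
                (sub 0 (0 ∷ 8 ∷ 2 ∷ 3 ∷ 4 ∷ []))
                (sub 0 (0 ∷ 4 ∷ 3 ∷ 2 ∷ 6 ∷ [])))
              (sub 1 (9 ∷ 6 ∷ 8 ∷ 0 ∷ 2 ∷ [])))
            (sub 1 (9 ∷ 3 ∷ 8 ∷ 0 ∷ 2 ∷ [])))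
          (sub 2 (2 ∷ 8 ∷ 9 ∷ 0 ∷ []))))) ∷
  entry (105 ∷ 11 ∷ 20 ∷ 9 ∷ 1 ∷ 1 ∷ 1 ∷ []) (keep ∷ keep ∷ keep ∷ keep ∷ copy 1 ∷ [])
    (ask 4
      stop
      (ask 1
        (ask 0
          (ask 2
            (sub 0 (0 ∷ 5 ∷ 1 ∷ 2 ∷ 3 ∷ []))
            (ask 6
              (sub 0 (0 ∷ 3 ∷ 2 ∷ 1 ∷ 7 ∷ []))
              (ask 3
                (sub 0 (0 ∷ 7 ∷ 1 ∷ 2 ∷ 4 ∷ []))
                (ask 7
                  (ask 5
                    (sub 8 (6 ∷ 4 ∷ 8 ∷ 7 ∷ 3 ∷ 2 ∷ 1 ∷ 5 ∷ 0 ∷ []))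
                    (sub 0 (0 ∷ 6 ∷ 2 ∷ 1 ∷ 8 ∷ [])))
                  (sub 1 (0 ∷ 2 ∷ 8 ∷ 4 ∷ 3 ∷ []))))))
          (ask 5
            (ask 7
              (ask 6
                (sub 0 (0 ∷ 5 ∷ 6 ∷ 7 ∷ 8 ∷ []))
                (sub 1 (0 ∷ 6 ∷ 1 ∷ 7 ∷ 5 ∷ [])))
              (sub 0 (8 ∷ 0 ∷ 5 ∷ 6 ∷ 2 ∷ [])))
            (sub 1 (0 ∷ 2 ∷ 5 ∷ 6 ∷ 1 ∷ []))))
        stop)) ∷
  entry (11 ∷ 20 ∷ 9 ∷ 1 ∷ 1 ∷ 1 ∷ []) (keep ∷ keep ∷ keep ∷ keep ∷ keep ∷ copy 1 ∷ [])
    (ask 5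
      stop
      (ask 1
        (ask 6
          (ask 3
            (ask 2
              (sub 0 (0 ∷ 6 ∷ 7 ∷ 3 ∷ 4 ∷ []))
              (ask 4
                (sub 0 (0 ∷ 3 ∷ 7 ∷ 2 ∷ 5 ∷ []))
                (ask 0
                  (sub 0 (0 ∷ 6 ∷ 7 ∷ 2 ∷ 1 ∷ []))
                  (sub 1 (0 ∷ 4 ∷ 1 ∷ 5 ∷ 3 ∷ [])))))
            (sub 0 (4 ∷ 0 ∷ 6 ∷ 7 ∷ 2 ∷ [])))
          (ask 4
            (ask 2
              (ask 3
                (sub 0 (0 ∷ 7 ∷ 3 ∷ 4 ∷ 5 ∷ []))
                (ask 0
                  (sub 0 (0 ∷ 7 ∷ 3 ∷ 1 ∷ 5 ∷ []))
                  (sub 9 (1 ∷ 0 ∷ 6 ∷ 4 ∷ 3 ∷ 7 ∷ 2 ∷ 5 ∷ []))))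
              (sub 0 (3 ∷ 0 ∷ 6 ∷ 5 ∷ 2 ∷ [])))
            (sub 1 (0 ∷ 2 ∷ 6 ∷ 7 ∷ 5 ∷ []))))
        stop)) ∷
  entry (20 ∷ 9 ∷ 1 ∷ 1 ∷ 1 ∷ []) (keep ∷ keep ∷ keep ∷ keep ∷ copy 0 ∷ [])
    (ask 4
      stop
      (ask 0
        (ask 5
          (ask 2
            (ask 1
              (sub 0 (0 ∷ 5 ∷ 6 ∷ 2 ∷ 3 ∷ []))
              (ask 3
                (sub 0 (0 ∷ 2 ∷ 6 ∷ 1 ∷ 4 ∷ []))
                (sub 10 (5 ∷ 0 ∷ 6 ∷ 1 ∷ 4 ∷ 3 ∷ 2 ∷ []))))
            (sub 0 (3 ∷ 0 ∷ 5 ∷ 6 ∷ 1 ∷ [])))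
          (ask 3
            (ask 2
              (sub 0 (0 ∷ 6 ∷ 1 ∷ 4 ∷ 3 ∷ []))
              (ask 1
                (sub 10 (5 ∷ 0 ∷ 4 ∷ 1 ∷ 6 ∷ 2 ∷ 3 ∷ []))
                (sub 0 (2 ∷ 0 ∷ 5 ∷ 4 ∷ 1 ∷ []))))
            (sub 1 (0 ∷ 1 ∷ 5 ∷ 6 ∷ 4 ∷ []))))
        stop)) ∷
  entry (23 ∷ 9 ∷ 1 ∷ 1 ∷ 1 ∷ []) (keep ∷ keep ∷ keep ∷ keep ∷ free ∷ [])
    (ask 4
      stop
      (ask 0
        (ask 5
          (ask 2
            (sub 0 (0 ∷ 5 ∷ 6 ∷ 1 ∷ 3 ∷ []))
            (ask 3
              (ask 1
                (sub 0 (0 ∷ 5 ∷ 4 ∷ 1 ∷ 2 ∷ []))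
                (sub 4 (2 ∷ 4 ∷ 1 ∷ 3 ∷ 6 ∷ 0 ∷ 5 ∷ [])))
              (ask 1
                (sub 6 (1 ∷ 4 ∷ 3 ∷ 2 ∷ 0 ∷ 6 ∷ 5 ∷ []))
                (sub 7 (2 ∷ 4 ∷ 3 ∷ 1 ∷ 0 ∷ 6 ∷ 5 ∷ [])))))
          (ask 3
            (ask 1
              (sub 0 (0 ∷ 5 ∷ 4 ∷ 1 ∷ 2 ∷ []))
              (ask 2
                (sub 6 (1 ∷ 6 ∷ 2 ∷ 3 ∷ 0 ∷ 4 ∷ 5 ∷ []))
                (sub 7 (3 ∷ 6 ∷ 2 ∷ 1 ∷ 0 ∷ 4 ∷ 5 ∷ []))))
            (sub 1 (0 ∷ 1 ∷ 5 ∷ 6 ∷ 4 ∷ []))))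
        (ask 1
          (ask 3
            (ask 2
              (sub 0 (0 ∷ 5 ∷ 4 ∷ 3 ∷ 2 ∷ []))
              (sub 1 (3 ∷ 5 ∷ 1 ∷ 0 ∷ 4 ∷ [])))
            (ask 2
              (ask 5
                (sub 0 (0 ∷ 5 ∷ 6 ∷ 2 ∷ 3 ∷ []))
                (sub 3 (1 ∷ 3 ∷ 2 ∷ 4 ∷ 6 ∷ 0 ∷ [])))
              (sub 2 (1 ∷ 3 ∷ 4 ∷ 0 ∷ []))))
          (ask 5
            (sub 1 (2 ∷ 5 ∷ 1 ∷ 0 ∷ 6 ∷ []))
            (sub 2 (1 ∷ 2 ∷ 6 ∷ 0 ∷ [])))))) ∷
  entry (25 ∷ 9 ∷ 1 ∷ 1 ∷ 1 ∷ []) (keep ∷ keep ∷ keep ∷ free ∷ [])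
    (ask 3
      stop
      (ask 5
        (ask 1
          (ask 2
            (sub 0 (0 ∷ 4 ∷ 3 ∷ 2 ∷ 6 ∷ []))
            (ask 4
              (sub 0 (0 ∷ 4 ∷ 5 ∷ 6 ∷ 2 ∷ []))
              (ask 0
                (sub 5 (1 ∷ 4 ∷ 5 ∷ 6 ∷ 0 ∷ 2 ∷ 3 ∷ []))
                (sub 12 (1 ∷ 5 ∷ 6 ∷ 2 ∷ 3 ∷ 0 ∷ [])))))
          (ask 4
            (ask 2
              (sub 11 (3 ∷ 5 ∷ 6 ∷ 2 ∷ 0 ∷ 4 ∷ []))
              (ask 0
                (sub 5 (1 ∷ 3 ∷ 2 ∷ 6 ∷ 0 ∷ 5 ∷ 4 ∷ []))
                (sub 12 (1 ∷ 2 ∷ 6 ∷ 5 ∷ 4 ∷ 0 ∷ []))))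
            (ask 2
              (ask 0
                (sub 1 (6 ∷ 0 ∷ 1 ∷ 5 ∷ 2 ∷ []))
                (sub 0 (6 ∷ 1 ∷ 0 ∷ 4 ∷ 3 ∷ [])))
              (sub 12 (0 ∷ 4 ∷ 3 ∷ 2 ∷ 6 ∷ 5 ∷ [])))))
        (ask 0
          (ask 2
            (sub 0 (3 ∷ 4 ∷ 0 ∷ 6 ∷ 1 ∷ []))
            (ask 4
              (ask 1
                (sub 0 (0 ∷ 4 ∷ 5 ∷ 1 ∷ 2 ∷ []))
                (sub 12 (6 ∷ 2 ∷ 1 ∷ 5 ∷ 4 ∷ 0 ∷ [])))
              (ask 1
                (sub 12 (6 ∷ 5 ∷ 1 ∷ 2 ∷ 3 ∷ 0 ∷ []))
                (sub 3 (0 ∷ 3 ∷ 4 ∷ 2 ∷ 5 ∷ 6 ∷ [])))))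
          (ask 4
            (sub 1 (6 ∷ 4 ∷ 1 ∷ 0 ∷ 5 ∷ []))
            (sub 2 (1 ∷ 5 ∷ 6 ∷ 0 ∷ [])))))) ∷
  entry (44 ∷ 21 ∷ 9 ∷ 1 ∷ 1 ∷ 1 ∷ []) (keep ∷ keep ∷ keep ∷ keep ∷ keep ∷ free ∷ [])
    (ask 5
      stop
      (ask 6
        (ask 3
          (ask 2
            (sub 0 (0 ∷ 6 ∷ 7 ∷ 3 ∷ 4 ∷ []))
            (ask 0
              (sub 0 (0 ∷ 6 ∷ 7 ∷ 1 ∷ 4 ∷ []))
              (ask 4
                (sub 11 (7 ∷ 5 ∷ 4 ∷ 3 ∷ 0 ∷ 6 ∷ []))
                (sub 1 (0 ∷ 7 ∷ 5 ∷ 6 ∷ 1 ∷ [])))))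
          (ask 1
            (sub 0 (4 ∷ 0 ∷ 6 ∷ 7 ∷ 2 ∷ []))
            (ask 4
              (ask 2
                (sub 11 (5 ∷ 7 ∷ 3 ∷ 4 ∷ 0 ∷ 6 ∷ []))
                (sub 1 (0 ∷ 5 ∷ 3 ∷ 4 ∷ 2 ∷ [])))
              (sub 1 (0 ∷ 7 ∷ 5 ∷ 6 ∷ 2 ∷ [])))))
        (ask 1
          (ask 4
            (ask 2
              (sub 0 (0 ∷ 6 ∷ 5 ∷ 2 ∷ 3 ∷ []))
              (sub 12 (7 ∷ 3 ∷ 0 ∷ 6 ∷ 5 ∷ 2 ∷ [])))
            (sub 1 (0 ∷ 2 ∷ 6 ∷ 7 ∷ 5 ∷ [])))
          (ask 2
            (ask 3
              (sub 0 (6 ∷ 0 ∷ 2 ∷ 3 ∷ 4 ∷ []))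
              (sub 1 (7 ∷ 4 ∷ 2 ∷ 0 ∷ 3 ∷ [])))
            (sub 2 (2 ∷ 3 ∷ 7 ∷ 0 ∷ [])))))) ∷
  entry (21 ∷ 9 ∷ 1 ∷ 1 ∷ 1 ∷ []) (keep ∷ keep ∷ keep ∷ keep ∷ free ∷ [])
    (ask 4
      stop
      (ask 5
        (ask 1
          (ask 2
            (sub 0 (0 ∷ 5 ∷ 6 ∷ 2 ∷ 3 ∷ []))
            (ask 3
              (sub 11 (4 ∷ 6 ∷ 2 ∷ 3 ∷ 0 ∷ 5 ∷ []))
              (sub 13 (4 ∷ 3 ∷ 2 ∷ 6 ∷ 5 ∷ 0 ∷ []))))
          (ask 0
            (ask 2
              (ask 3
                (sub 11 (6 ∷ 4 ∷ 3 ∷ 2 ∷ 0 ∷ 5 ∷ []))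
                (sub 14 (1 ∷ 0 ∷ 5 ∷ 6 ∷ 2 ∷ 3 ∷ 4 ∷ [])))
              (sub 0 (3 ∷ 0 ∷ 5 ∷ 6 ∷ 1 ∷ [])))
            (sub 1 (2 ∷ 5 ∷ 1 ∷ 0 ∷ 6 ∷ []))))
        (ask 0
          (ask 3
            (ask 1
              (sub 0 (0 ∷ 5 ∷ 4 ∷ 1 ∷ 2 ∷ []))
              (sub 12 (6 ∷ 2 ∷ 0 ∷ 5 ∷ 4 ∷ 1 ∷ [])))
            (sub 1 (0 ∷ 1 ∷ 5 ∷ 6 ∷ 4 ∷ [])))
          (ask 1
            (ask 2
              (sub 0 (5 ∷ 0 ∷ 1 ∷ 2 ∷ 3 ∷ []))
              (sub 1 (6 ∷ 3 ∷ 1 ∷ 0 ∷ 2 ∷ [])))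
            (sub 2 (1 ∷ 2 ∷ 6 ∷ 0 ∷ [])))))) ∷
  -- The 5-cycle, contained in all entries above.
  entry (9 ∷ 1 ∷ 1 ∷ 1 ∷ []) (keep ∷ keep ∷ keep ∷ keep ∷ free ∷ [])
    (ask 4
      stop
      (ask 2
        (ask 1
          (ask 3
            (sub 0 (0 ∷ 5 ∷ 4 ∷ 3 ∷ 2 ∷ []))
            (ask 0
              (sub 0 (0 ∷ 5 ∷ 1 ∷ 2 ∷ 3 ∷ []))
              (sub 13 (5 ∷ 1 ∷ 2 ∷ 3 ∷ 4 ∷ 0 ∷ []))))
          (ask 3
            (ask 0
              (sub 11 (1 ∷ 4 ∷ 3 ∷ 2 ∷ 0 ∷ 5 ∷ []))
              (sub 13 (1 ∷ 2 ∷ 3 ∷ 4 ∷ 5 ∷ 0 ∷ [])))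
            (ask 0
              (sub 15 (0 ∷ 4 ∷ 3 ∷ 2 ∷ 1 ∷ 5 ∷ []))
              (sub 12 (0 ∷ 5 ∷ 1 ∷ 2 ∷ 3 ∷ 4 ∷ [])))))
        (ask 3
          (ask 1
            (ask 0
              (sub 11 (4 ∷ 1 ∷ 2 ∷ 3 ∷ 0 ∷ 5 ∷ []))
              (sub 15 (0 ∷ 1 ∷ 2 ∷ 3 ∷ 4 ∷ 5 ∷ [])))
            (ask 0
              (sub 15 (0 ∷ 2 ∷ 1 ∷ 5 ∷ 4 ∷ 3 ∷ []))
              (sub 12 (0 ∷ 1 ∷ 2 ∷ 3 ∷ 4 ∷ 5 ∷ []))))
          (ask 1
            (ask 0
              (sub 13 (4 ∷ 3 ∷ 2 ∷ 1 ∷ 5 ∷ 0 ∷ []))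
              (sub 12 (0 ∷ 4 ∷ 5 ∷ 1 ∷ 2 ∷ 3 ∷ [])))
            (ask 0
              (sub 12 (0 ∷ 4 ∷ 3 ∷ 2 ∷ 1 ∷ 5 ∷ []))
              (sub 3 (0 ∷ 2 ∷ 3 ∷ 1 ∷ 4 ∷ 5 ∷ []))))))) ∷
  -- From here on the four oldest vertices form a paw, up to the entry for the paw itself,
  -- `5 ∷ 2 ∷ 1 ∷ []`.
  entry (13 ∷ 5 ∷ 5 ∷ 2 ∷ 1 ∷ []) (keep ∷ keep ∷ keep ∷ free ∷ keep ∷ free ∷ [])
    (ask 5
      (ask 3
        stop
        (ask 4
          (ask 1
            (sub 0 (0 ∷ 4 ∷ 6 ∷ 5 ∷ 2 ∷ []))
            (sub 16 (2 ∷ 5 ∷ 6 ∷ 4 ∷ 0 ∷ [])))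
          (ask 0
            (ask 2
              (ask 1
                (sub 16 (4 ∷ 3 ∷ 2 ∷ 5 ∷ 0 ∷ []))
                (sub 1 (5 ∷ 4 ∷ 2 ∷ 0 ∷ 1 ∷ [])))
              (sub 1 (4 ∷ 5 ∷ 3 ∷ 0 ∷ 6 ∷ [])))
            (sub 1 (0 ∷ 6 ∷ 1 ∷ 5 ∷ 4 ∷ [])))))
      (ask 3
        (ask 0
          (ask 1
            (sub 0 (0 ∷ 6 ∷ 4 ∷ 1 ∷ 2 ∷ []))
            (sub 16 (2 ∷ 1 ∷ 4 ∷ 6 ∷ 0 ∷ [])))
          (ask 4
            (ask 2
              (ask 1
                (sub 16 (1 ∷ 2 ∷ 3 ∷ 6 ∷ 0 ∷ []))
                (sub 1 (2 ∷ 6 ∷ 1 ∷ 0 ∷ 5 ∷ [])))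
              (sub 1 (6 ∷ 1 ∷ 3 ∷ 0 ∷ 4 ∷ [])))
            (sub 1 (0 ∷ 4 ∷ 5 ∷ 6 ∷ 1 ∷ []))))
        (ask 2
          (ask 1
            (ask 0
              (sub 0 (0 ∷ 6 ∷ 3 ∷ 2 ∷ 1 ∷ []))
              (sub 16 (1 ∷ 2 ∷ 3 ∷ 6 ∷ 0 ∷ [])))
            (sub 1 (6 ∷ 2 ∷ 4 ∷ 0 ∷ 3 ∷ [])))
          (sub 2 (3 ∷ 4 ∷ 6 ∷ 0 ∷ []))))) ∷
  entry (5 ∷ 5 ∷ 2 ∷ 1 ∷ []) (keep ∷ keep ∷ free ∷ [])
    (ask 2
      stop
      (ask 4
        (ask 3
          (ask 0
            (sub 0 (0 ∷ 3 ∷ 5 ∷ 4 ∷ 1 ∷ []))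
            (sub 16 (1 ∷ 4 ∷ 5 ∷ 3 ∷ 0 ∷ [])))
          (ask 1
            (ask 0
              (sub 16 (3 ∷ 2 ∷ 1 ∷ 4 ∷ 0 ∷ []))
              (sub 17 (5 ∷ 2 ∷ 1 ∷ 4 ∷ 3 ∷ 0 ∷ [])))
            (sub 1 (3 ∷ 4 ∷ 2 ∷ 0 ∷ 5 ∷ []))))
        (ask 1
          (ask 0
            (ask 3
              (sub 0 (0 ∷ 3 ∷ 2 ∷ 1 ∷ 4 ∷ []))
              (sub 16 (3 ∷ 2 ∷ 1 ∷ 4 ∷ 0 ∷ [])))
            (sub 1 (5 ∷ 1 ∷ 3 ∷ 0 ∷ 2 ∷ [])))
          (sub 2 (2 ∷ 3 ∷ 5 ∷ 0 ∷ []))))) ∷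
  entry (6 ∷ 13 ∷ 5 ∷ 2 ∷ 1 ∷ []) (keep ∷ keep ∷ keep ∷ keep ∷ copy 2 ∷ [])
    (ask 4
      stop
      (ask 2
        (ask 1
          (ask 0
            (sub 0 (0 ∷ 5 ∷ 2 ∷ 3 ∷ 1 ∷ []))
            (sub 16 (1 ∷ 3 ∷ 2 ∷ 5 ∷ 0 ∷ [])))
          (ask 5
            (ask 0
              (sub 0 (0 ∷ 5 ∷ 6 ∷ 3 ∷ 1 ∷ []))
              (sub 16 (1 ∷ 3 ∷ 6 ∷ 5 ∷ 0 ∷ [])))
            (sub 2 (2 ∷ 5 ∷ 6 ∷ 0 ∷ []))))
        stop)) ∷
  entry (13 ∷ 5 ∷ 2 ∷ 1 ∷ []) (keep ∷ keep ∷ keep ∷ copy 1 ∷ [])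
    (ask 3
      stop
      (ask 1
        (ask 0
          (ask 2
            (sub 0 (0 ∷ 4 ∷ 1 ∷ 2 ∷ 3 ∷ []))
            (sub 16 (3 ∷ 2 ∷ 1 ∷ 4 ∷ 0 ∷ [])))
          (ask 4
            (ask 2
              (sub 19 (3 ∷ 4 ∷ 5 ∷ 2 ∷ 0 ∷ 1 ∷ []))
              (sub 1 (5 ∷ 0 ∷ 2 ∷ 3 ∷ 1 ∷ [])))
            (sub 2 (1 ∷ 4 ∷ 5 ∷ 0 ∷ []))))
        stop)) ∷
  entry (20 ∷ 4 ∷ 5 ∷ 2 ∷ 1 ∷ []) (keep ∷ keep ∷ copy 0 ∷ [])
    (ask 2
      stop
      (ask 5
        (ask 4
          (ask 1
            (sub 0 (0 ∷ 3 ∷ 6 ∷ 5 ∷ 2 ∷ []))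
            (sub 16 (2 ∷ 5 ∷ 6 ∷ 3 ∷ 0 ∷ [])))
          (ask 3
            (sub 18 (5 ∷ 6 ∷ 4 ∷ 0 ∷ 3 ∷ []))
            (sub 1 (4 ∷ 5 ∷ 3 ∷ 0 ∷ 6 ∷ []))))
        (ask 3
          (ask 0
            (sub 20 (3 ∷ 4 ∷ 1 ∷ 0 ∷ 6 ∷ []))
            stop)
          (sub 2 (3 ∷ 4 ∷ 6 ∷ 0 ∷ []))))) ∷
  entry (4 ∷ 5 ∷ 2 ∷ 1 ∷ []) (keep ∷ keep ∷ free ∷ [])
    (ask 2
      stop
      (ask 4
        (ask 3
          (ask 0
            (sub 0 (0 ∷ 3 ∷ 5 ∷ 4 ∷ 1 ∷ []))
            (sub 16 (1 ∷ 4 ∷ 5 ∷ 3 ∷ 0 ∷ [])))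
          (ask 1
            (sub 18 (4 ∷ 5 ∷ 2 ∷ 0 ∷ 3 ∷ []))
            (sub 1 (3 ∷ 4 ∷ 2 ∷ 0 ∷ 5 ∷ []))))
        (ask 1
          (ask 3
            (ask 0
              (sub 21 (2 ∷ 1 ∷ 0 ∷ 3 ∷ 4 ∷ 5 ∷ []))
              (sub 0 (4 ∷ 1 ∷ 0 ∷ 3 ∷ 2 ∷ [])))
            (sub 20 (3 ∷ 0 ∷ 4 ∷ 2 ∷ 5 ∷ [])))
          (sub 2 (2 ∷ 3 ∷ 5 ∷ 0 ∷ []))))) ∷
  entry (24 ∷ 12 ∷ 5 ∷ 2 ∷ 1 ∷ []) (keep ∷ copy 0 ∷ [])
    (ask 1
      stop
      (ask 5
        (ask 3
          (ask 2
            (sub 22 (0 ∷ 3 ∷ 4 ∷ 2 ∷ 6 ∷ []))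
            (sub 18 (2 ∷ 6 ∷ 4 ∷ 0 ∷ 3 ∷ [])))
          (ask 4
            (sub 18 (4 ∷ 6 ∷ 5 ∷ 0 ∷ 2 ∷ []))
            (sub 1 (5 ∷ 4 ∷ 2 ∷ 0 ∷ 6 ∷ []))))
        (ask 4
          (ask 0
            (sub 20 (2 ∷ 5 ∷ 1 ∷ 0 ∷ 6 ∷ []))
            stop)
          (sub 2 (2 ∷ 5 ∷ 6 ∷ 0 ∷ []))))) ∷
  entry (12 ∷ 5 ∷ 2 ∷ 1 ∷ []) (keep ∷ keep ∷ keep ∷ free ∷ [])
    (ask 3
      stop
      (ask 4
        (ask 2
          (ask 1
            (sub 22 (0 ∷ 2 ∷ 3 ∷ 4 ∷ 5 ∷ []))
            (sub 18 (4 ∷ 5 ∷ 3 ∷ 0 ∷ 2 ∷ [])))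
          (ask 1
            (sub 18 (4 ∷ 5 ∷ 2 ∷ 0 ∷ 3 ∷ []))
            (sub 1 (3 ∷ 4 ∷ 2 ∷ 0 ∷ 5 ∷ []))))
        (ask 0
          (ask 2
            (ask 1
              (sub 23 (1 ∷ 0 ∷ 2 ∷ 3 ∷ 4 ∷ 5 ∷ []))
              (sub 0 (3 ∷ 2 ∷ 0 ∷ 4 ∷ 1 ∷ [])))
            (sub 20 (4 ∷ 0 ∷ 3 ∷ 1 ∷ 5 ∷ [])))
          (sub 2 (1 ∷ 4 ∷ 5 ∷ 0 ∷ []))))) ∷
  entry (5 ∷ 2 ∷ 1 ∷ []) (keep ∷ keep ∷ free ∷ [])
    (ask 2
      stop
      (ask 3
        (ask 1
          (ask 0
            (sub 22 (0 ∷ 1 ∷ 2 ∷ 3 ∷ 4 ∷ []))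
            (sub 18 (3 ∷ 4 ∷ 2 ∷ 0 ∷ 1 ∷ [])))
          (ask 0
            (sub 18 (3 ∷ 4 ∷ 1 ∷ 0 ∷ 2 ∷ []))
            (sub 1 (2 ∷ 3 ∷ 1 ∷ 0 ∷ 4 ∷ []))))
        (ask 1
          (ask 0
            (sub 24 (3 ∷ 1 ∷ 2 ∷ 0 ∷ 4 ∷ []))
            (sub 20 (1 ∷ 0 ∷ 3 ∷ 2 ∷ 4 ∷ [])))
          (ask 0
            (sub 20 (2 ∷ 0 ∷ 3 ∷ 1 ∷ 4 ∷ []))
            (sub 2 (1 ∷ 2 ∷ 4 ∷ 0 ∷ [])))))) ∷
  -- The path P₄: a new vertex that sees the end but not the copied vertex gives a paw, P₅ or a
  -- 5-cycle.
  entry (1 ∷ 2 ∷ 1 ∷ []) (keep ∷ keep ∷ copy 1 ∷ [])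
    (ask 2
      stop
      (ask 1
        (ask 3
          (ask 0
            (sub 0 (0 ∷ 3 ∷ 4 ∷ 2 ∷ 1 ∷ []))
            (sub 16 (1 ∷ 2 ∷ 4 ∷ 3 ∷ 0 ∷ [])))
          (sub 25 (3 ∷ 0 ∷ 2 ∷ 4 ∷ [])))
        stop)) ∷
  entry (2 ∷ 1 ∷ []) (keep ∷ copy 0 ∷ [])
    (ask 1
      stop
      (ask 0
        (ask 2
          (sub 26 (1 ∷ 3 ∷ 0 ∷ 2 ∷ []))
          (sub 25 (2 ∷ 0 ∷ 1 ∷ 3 ∷ [])))
        stop)) ∷
  -- A new vertex that sees part of a triangle completes K₄ or creates the P₃ already excluded.
  entry (3 ∷ 1 ∷ []) (keep ∷ keep ∷ free ∷ [])
    (ask 2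
      stop
      (ask 1
        (sub 27 (2 ∷ 0 ∷ 3 ∷ []))
        (ask 0
          (sub 27 (1 ∷ 0 ∷ 3 ∷ []))
          (sub 2 (1 ∷ 2 ∷ 3 ∷ 0 ∷ []))))) ∷
  entry (1 ∷ []) (keep ∷ free ∷ [])
    (ask 1
      stop
      (ask 0
        (sub 27 (1 ∷ 0 ∷ 2 ∷ []))
        (sub 28 (1 ∷ 2 ∷ 0 ∷ [])))) ∷
  entry [] (free ∷ [])
    (ask 0
      stop
      (sub 29 (1 ∷ 0 ∷ []))) ∷
  []

module Gem = Classification P5 gem gemCodes gemEntries
module CoP3P2 = Classification P5 coP3P2 coP3P2Codes coP3P2Entries

theorem3p5 : ExactlyUpToIso 3 (λ G → VertexCritical 4 G × Free G P5 × Free G gem)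
           × ExactlyUpToIso 6 (λ G → VertexCritical 4 G × Free G P5 × Free G coP3P2)
-- Each `checked?` reduces to `yes` during type checking, which carries out the whole finite
-- verification.
theorem3p5 = Gem.classification (toWitness {a? = Gem.checked?} tt) ,
             CoP3P2.classification (toWitness {a? = CoP3P2.checked?} tt)
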